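{- Let $\Gamma$ be a distance-regular graph with valency $k\geq 3$, diameter $D\geq 2$, $a_1\neq 0$ and distinct eigenvalues $\theta_0>\theta_1>\cdots>\theta_D=-\frac{k}{a_1+1}$. If $c_2=(a_1+1)^2+1$ and $\Gamma$ contains an induced subgraph isomorphic to a generalized quadrangle $GQ(a_1+1,c_2-1)$, then $\theta_1=\frac{k-(a_1+1)(a_1+2)}{(a_1+1)^2}$ and $E_D$ is a light tail with associated minimal idempotent $E_1$.
   Context: A connected graph $\Gamma$ of diameter $D$ is distance-regular if there are integers $b_i,c_i$ ($0\le i\le D$) such that for any vertices $x,y$ at distance $i$, $y$ has exactly $c_i$ neighbours at distance $i-1$ from $x$ and $b_i$ neighbours at distance $i+1$ from $x$; $k=b_0$ and $a_i=k-b_i-c_i$. The eigenvalues are those of the adjacency matrix; $E_i$ denotes the orthogonal projection onto the $\theta_i$-eigenspace, with $E_0=\frac1n J$ ($n$ the number of vertices). A minimal idempotent $E$ is a light tail if $E\circ E=aE_0+bF$ (entrywise product) for some minimal idempotent $F\neq E_0$ and nonzero reals $a,b$; $F$ is the associated minimal idempotent. A generalized quadrangle $GQ(s,t)$ is a $K_{1,1,2}$-free distance-regular graph of diameter $2$ with intersection array $\{(t+1)s,ts;1,t+1\}$. -}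

module Defs where

open import Algebra.Apartness.Bundles using (HeytingField)
open import Algebra.Bundles using (CommutativeRing)
import Algebra.Definitions.RawMonoid as RawMonoidDefs
open import Data.Fin.Base using (Fin)
open import Data.Fin.Patterns using (0F; 1F; 2F)
import Data.Fin.Properties as Fin
open import Data.Fin.Subset using (Subset; _∈_; ∣_∣)
open import Data.Nat.Base as ℕ using (ℕ; zero; suc; NonZero)
open import Data.Product.Base using (_×_; _,_; ∃; ∃-syntax; ∃₂; proj₁; proj₂)
open import Data.Sum.Base using (_⊎_; inj₁; inj₂)
open import Data.Vec.Functional using (Vector; []; _∷_)
open import Data.Bool.Base using (if_then_else_)
open import Function.Bundles using (_⇔_; Equivalence)
open import Function.Definitions using (Injective)
open import Level using (Level; 0ℓ; _⊔_) renaming (suc to lsuc)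
open import Relation.Binary.Core using (Rel)
open import Relation.Binary.Definitions using (Decidable; Symmetric; Irreflexive)
open import Relation.Binary.PropositionalEquality.Core using (_≡_; _≢_; refl; ≢-sym)
open import Relation.Binary.Structures using (IsStrictPartialOrder)
open import Relation.Nullary.Decidable.Core using (does; ¬?)
open import Relation.Nullary.Negation.Core using (¬_; contradiction)
open import Relation.Unary using (Pred)

------------------------------------------------------------------------
-- The real numbers

-- The library has no real numbers, so they are axiomatised as a
-- Cauchy-complete Archimedean ordered field. The formulation is
-- constructive: the order is not assumed decidable, and "x ≠ y" is the
-- apartness "x < y or y < x". Classically any two models are isomorphic
-- to ℝ; constructively the Cauchy reals (as a setoid) are a model.

record RealNumbers (c ℓ₁ ℓ₂ : Level) : Set (lsuc (c ⊔ ℓ₁ ⊔ ℓ₂)) where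
  field
    heytingField : HeytingField c ℓ₁ ℓ₂

  open HeytingField heytingField public

  commutativeRing : CommutativeRing c ℓ₁
  commutativeRing = record { isCommutativeRing = isCommutativeRing }

  open CommutativeRing commutativeRing public using (+-rawMonoid)

  open RawMonoidDefs +-rawMonoid public using (sum)
  open RawMonoidDefs +-rawMonoid using () renaming (_×_ to _·_)

  fromℕ : ℕ → Carrier
  fromℕ m = m · 1#

  infix 4 _<_
  field
    _<_                  : Rel Carrier ℓ₂
    isStrictPartialOrder : IsStrictPartialOrder _≈_ _<_
    #⇔<⊎>                : ∀ {x y} → (x # y) ⇔ (x < y ⊎ y < x)
    0<1                  : 0# < 1#
    +-monoˡ-<            : ∀ {x y} z → x < y → (x + z) < (y + z)
    *-pos                : ∀ {x y} → 0# < x → 0# < y → 0# < (x * y)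
    archimedean          : ∀ x → ∃[ m ] (x < fromℕ m)

  module < = IsStrictPartialOrder isStrictPartialOrder

  IsCauchy : (ℕ → Carrier) → Set (c ⊔ ℓ₂)
  IsCauchy u = ∀ ε → 0# < ε →
    ∃[ N ] (∀ m n → N ℕ.≤ m → N ℕ.≤ n → u m < (u n + ε))

  _ConvergesTo_ : (ℕ → Carrier) → Carrier → Set (c ⊔ ℓ₂)
  u ConvergesTo l = ∀ ε → 0# < ε →
    ∃[ N ] (∀ n → N ℕ.≤ n → (u n < (l + ε)) × (l < (u n + ε)))

  field
    complete : ∀ u → IsCauchy u → ∃[ l ] (u ConvergesTo l)

  fromℕ-positive : ∀ m → 0# < fromℕ (suc m)
  fromℕ-positive zero    = <.<-respʳ-≈ (<.Eq.sym (+-identityʳ 1#)) 0<1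
  fromℕ-positive (suc m) =
    <.trans (fromℕ-positive m)
      (<.<-respˡ-≈ (+-identityˡ _) (+-monoˡ-< (fromℕ (suc m)) 0<1))

  fromℕ#0 : ∀ m → .{{NonZero m}} → fromℕ m # 0#
  fromℕ#0 (suc m) = Equivalence.from #⇔<⊎> (inj₂ (fromℕ-positive m))

  -- The library's #⇒invertible inverts x - y, here fromℕ m - 0#.
  infixl 7 _÷_
  _÷_ : Carrier → (m : ℕ) → .{{NonZero m}} → Carrier
  x ÷ m = x * proj₁ (#⇒invertible (fromℕ#0 m))

  ÷-correct : ∀ x m → .{{_ : NonZero m}} → ((x ÷ m) * fromℕ m) ≈ x
  ÷-correct x m = begin
    (x * i) * fromℕ m          ≈⟨ *-assoc x i (fromℕ m) ⟩
    x * (i * fromℕ m)          ≈⟨ *-congˡ (*-congˡ (+-identityʳ (fromℕ m))) ⟨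
    x * (i * (fromℕ m + 0#))   ≈⟨ *-congˡ (*-congˡ (+-congˡ -0#≈0#)) ⟨
    x * (i * (fromℕ m - 0#))   ≈⟨ *-congˡ (proj₁ (proj₂ inv)) ⟩
    x * 1#                     ≈⟨ *-identityʳ x ⟩
    x                          ∎
    where
    open CommutativeRing commutativeRing using (ring)
    open import Relation.Binary.Reasoning.Setoid setoid
    open import Algebra.Properties.Ring ring using (-0#≈0#)
    inv = #⇒invertible (fromℕ#0 m)
    i   = proj₁ inv

------------------------------------------------------------------------
-- Finite simple graphs

record Graph (n : ℕ) : Set₁ where
  infix 4 _~_ _~?_
  field
    _~_      : Rel (Fin n) 0ℓ
    _~?_     : Decidable _~_
    ~-sym    : Symmetric _~_
    ~-irrefl : Irreflexive _≡_ _~_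

completeMultipartite : ∀ {n p} → (Fin n → Fin p) → Graph n
completeMultipartite part = record
  { _~_      = λ x y → part x ≢ part y
  ; _~?_     = λ x y → ¬? (part x Fin.≟ part y)
  ; ~-sym    = ≢-sym
  ; ~-irrefl = λ { refl p≢p → contradiction refl p≢p }
  }

K₁₁₂ : Graph 4
K₁₁₂ = completeMultipartite {p = 3} (0F ∷ 1F ∷ 2F ∷ 2F ∷ [])

record _InducedIn_ {m n : ℕ} (H : Graph m) (Γ : Graph n) : Set where
  private
    module H = Graph H
    module Γ = Graph Γ
  field
    embed     : Fin m → Fin n
    injective : Injective _≡_ _≡_ embed
    adjacency : ∀ {x y} → (x H.~ y) ⇔ (embed x Γ.~ embed y)

data Walk {n : ℕ} (Γ : Graph n) : Fin n → Fin n → ℕ → Set where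
  stop : ∀ {x} → Walk Γ x x 0
  step : ∀ {x y z l} → Graph._~_ Γ x y → Walk Γ y z l → Walk Γ x z (suc l)

Dist : ∀ {n} → Graph n → Fin n → Fin n → ℕ → Set
Dist Γ x y d = Walk Γ x y d × (∀ {l} → Walk Γ x y l → d ℕ.≤ l)

Exactly : ∀ {n} → ℕ → Pred (Fin n) 0ℓ → Set
Exactly m P = ∃[ S ] ((∀ z → (z ∈ S) ⇔ P z) × ∣ S ∣ ≡ m)

-- The intersection numbers b i, c i only matter for i ≤ D; their values
-- at larger i are unconstrained. No vertex is at distance "0 - 1", so
-- c 0 ≡ 0 is forced, as is b D ≡ 0.

record IsDistanceRegular {n : ℕ} (Γ : Graph n) (D : ℕ) (b c : ℕ → ℕ) : Set where
  open Graph Γ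
  field
    connected : ∀ x y → ∃[ l ] Walk Γ x y l
    bounded   : ∀ {x y d} → Dist Γ x y d → d ℕ.≤ D
    attained  : ∃₂ λ x y → Dist Γ x y D
    c-count   : ∀ {x y i} → Dist Γ x y i →
                Exactly (c i) (λ z → (y ~ z) × ∃[ j ] (i ≡ suc j × Dist Γ x z j))
    b-count   : ∀ {x y i} → Dist Γ x y i →
                Exactly (b i) (λ z → (y ~ z) × Dist Γ x z (suc i))

-- aᵢ = k - bᵢ - cᵢ with k = b₀. For i ≤ D the truncated subtraction is
-- the true one, since the bᵢ + cᵢ vertices counted are among k neighbours.

intersection-a : (b c : ℕ → ℕ) → ℕ → ℕ
intersection-a b c i = b 0 ℕ.∸ b i ℕ.∸ c i

IsGQ : ∀ {n} → (s t : ℕ) → Graph n → Set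
IsGQ s t Q =
  ¬ (K₁₁₂ InducedIn Q) ×
  (∃₂ λ b c → IsDistanceRegular Q 2 b c ×
     b 0 ≡ (t ℕ.+ 1) ℕ.* s × b 1 ≡ t ℕ.* s ×
     c 1 ≡ 1 × c 2 ≡ t ℕ.+ 1)

ContainsInducedGQ : ∀ {n} → (s t : ℕ) → Graph n → Set₁
ContainsInducedGQ s t Γ = ∃₂ λ m (Q : Graph m) → IsGQ s t Q × (Q InducedIn Γ)

------------------------------------------------------------------------
-- Spectral notions

module Spectral {c ℓ₁ ℓ₂ : Level} (ℝ : RealNumbers c ℓ₁ ℓ₂) where

  open RealNumbers ℝ using (_#_; _<_; _+_; _*_; 0#; 1#; sum)
  open RealNumbers ℝ public using (Carrier; _≈_; -_; _-_; _÷_; fromℕ)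

  Matrix : ℕ → Set c
  Matrix n = Fin n → Vector Carrier n

  module _ {n : ℕ} where

    adjacencyMatrix : Graph n → Matrix n
    adjacencyMatrix Γ x y = if does (Graph._~?_ Γ x y) then 1# else 0#

    _*ᵥ_ : Matrix n → Vector Carrier n → Vector Carrier n
    (M *ᵥ v) x = sum (λ y → M x y * v y)

    ⟨_,_⟩ : Vector Carrier n → Vector Carrier n → Carrier
    ⟨ v , w ⟩ = sum (λ x → v x * w x)

    Eigenspace : Matrix n → Carrier → Pred (Vector Carrier n) ℓ₁
    Eigenspace M μ v = ∀ x → (M *ᵥ v) x ≈ (μ * v x)

    IsEigenvalue : Matrix n → Carrier → Set (c ⊔ ℓ₁ ⊔ ℓ₂)
    IsEigenvalue M μ = ∃[ v ] (Eigenspace M μ v × ∃[ x ] (v x # 0#))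

    -- θ 0 > θ 1 > ⋯ > θ D are all the eigenvalues of M; values of θ
    -- beyond D are unconstrained.

    record DistinctEigenvalues (M : Matrix n) (D : ℕ) (θ : ℕ → Carrier)
                               : Set (c ⊔ ℓ₁ ⊔ ℓ₂) where
      field
        decreasing  : ∀ {i j} → i ℕ.< j → j ℕ.≤ D → θ j < θ i
        eigenvalues : ∀ {i} → i ℕ.≤ D → IsEigenvalue M (θ i)
        exhaustive  : ∀ {μ} → IsEigenvalue M μ → ∃[ i ] (i ℕ.≤ D × μ ≈ θ i)

    IsOrthogonalProjection : Matrix n → Pred (Vector Carrier n) ℓ₁ → Set (c ⊔ ℓ₁)
    IsOrthogonalProjection E V =
      ∀ v → V (E *ᵥ v) × (∀ w → V w → ⟨ (λ x → v x - (E *ᵥ v) x) , w ⟩ ≈ 0#)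

    -- For the adjacency matrix M of a distance-regular graph, the minimal
    -- idempotents are the orthogonal projections onto the eigenspaces of M.

    IsMinimalIdempotent : Matrix n → Matrix n → Set (c ⊔ ℓ₁ ⊔ ℓ₂)
    IsMinimalIdempotent M E =
      ∃[ μ ] (IsEigenvalue M μ × IsOrthogonalProjection E (Eigenspace M μ))

    -- E is a light tail with associated minimal idempotent F, where E₀ is
    -- the projection onto the eigenspace of the largest eigenvalue.

    record IsLightTail (M E₀ E F : Matrix n) : Set (c ⊔ ℓ₁ ⊔ ℓ₂) where
      field
        E-minimal : IsMinimalIdempotent M E
        F-minimal : IsMinimalIdempotent M F
        F≠E₀      : ∃₂ λ x y → F x y # E₀ x y
        α β       : Carrier
        α≠0       : α # 0#
        β≠0       : β # 0#
        E∘E       : ∀ x y → (E x y * E x y) ≈ (α * E₀ x y + β * F x y)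

module Submission where

-- Write s = a₁ + 1, let ωᵢ be the cosines of θ_D = -k/s, so ω₁ = -1/s and ω₂ = 1/s², and let G be
-- the matrix with entries ω_{d(x,y)}, a positive multiple of E_D. On the quadrangle GQ(s,s²) the
-- entries of G∘G∘G sum to zero (the extremal case of the Krein condition), and this sum is a
-- multiple of the squared norm of the tensor ∑_{q∈Q} G_q ⊗ G_q ⊗ G_q, which therefore vanishes:
-- ∑_{q∈Q} G(q,y) G(q,x)² = 0 for all x and y. Multiplying by an entry of P in the Bose–Mesner
-- algebra and summing over x, with M = G∘G and y ∈ Q, turns this into a linear relation between the
-- values of MP at distances 0, 1, 2, which says that (A - k)(A - η)MP has zero diagonal for
-- η = (k - s(s+1))/s². With P = (A - k)(A - η)M this gives tr P² = 0, hence P = 0, so M is a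
-- combination of E₀ and the projection onto the η-eigenspace. Finally, pairing G with the Gram
-- matrix of any eigenvalue ν < k over Q gives (ν - k)(ν - η) ≥ 0, so η is the second largest one.

open import Algebra.Bundles using (CommutativeRing)
import Algebra.Properties.Ring as RingProperties
import Algebra.Properties.Semiring.Mult as SemiringMult
import Algebra.Properties.Semiring.Mult.TCOptimised as SemiringMultOptimised
import Algebra.Properties.Semiring.Sum as SemiringSum
import Algebra.Solver.Ring as RingSolver
open import Algebra.Solver.Ring.AlmostCommutativeRing
  using (fromCommutativeRing; _-Raw-AlmostCommutative⟶_)
open import Data.Bool.Base using (Bool; true; false; if_then_else_)
open import Data.Empty using (⊥-elim)
open import Data.Fin.Base using (Fin; zero; suc)
import Data.Fin.Properties as Fin
open import Data.Fin.Subset using (Subset; _∈_; _⊆_; ⁅_⁆; ∣_∣)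
open import Data.Fin.Subset.Properties
  using (x∈p⇒∣p-x∣<∣p∣; x∈⁅x⁆; x∈⁅y⁆⇒x≡y; ∣⁅x⁆∣≡1; ⊆-antisym)
open import Data.Integer.Base as ℤ using (ℤ; +_; -[1+_]; _⊖_)
import Data.Integer.Properties as ℤ
open import Data.Maybe.Base as Maybe using (Maybe)
open import Data.Nat.Base as ℕ using (ℕ; zero; suc; NonZero; z≤n; s≤s)
import Data.Nat.Induction as ℕ
import Data.Nat.Properties as ℕ
open import Data.Product.Base using (_×_; _,_; ∃-syntax; ∃₂; proj₁; proj₂)
open import Data.Sum.Base using (_⊎_; inj₁; inj₂; [_,_]′)
open import Data.Vec.Base using ([]; _∷_; lookup)
open import Data.Vec.Functional using (Vector)
open import Data.Vec.Properties using ([]=⇒lookup; lookup⇒[]=)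
open import Function.Base using (_∘_)
open import Function.Bundles using (Equivalence; mk⇔)
open import Level using (Level)
open import Relation.Binary.Definitions using (tri<; tri≈; tri>)
import Relation.Binary.Reasoning.Setoid as SetoidReasoning
open import Relation.Binary.PropositionalEquality.Core as ≡ using (_≡_; _≢_)
open import Relation.Nullary.Decidable.Core using (Dec; yes; no; does; _×-dec_; map′)
open import Relation.Nullary.Decidable using (does-⇔; dec⇒maybe; dec-true; dec-false)
open import Relation.Nullary.Negation.Core using (¬_; contradiction)
open import Relation.Unary using (Pred)
open import Defs

-- The matrix `A` is never diagonalised, and the order on the reals is not decidable. A matrix of
-- the Bose-Mesner algebra is therefore given by its sequence of values over the distances, on which
-- `A` acts as the tridiagonal operator `B`. That every such matrix is a polynomial in `A` does the
-- work of a spectral decomposition: it yields closure under products, diagonals that are constant,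
-- and a single scalar on each eigenspace. Idempotents enter only through cosine sequences, and a
-- matrix is shown to vanish by computing the norm of one of its rows, since a vanishing sum of
-- squares is what produces an equation without deciding any sign. The vertex `y` has to lie in `Q`
-- in the linear relation because only from there are the numbers of vertices of `Q` at each
-- distance known; the passage to all vertices of `Γ` is made by the constant diagonal.

-- Arithmetic and order in the constructive reals.

module RealProperties {ℓ ℓ₁ ℓ₂ : Level} (ℝ : RealNumbers ℓ ℓ₁ ℓ₂) where

  open RealNumbers ℝ public hiding (commutativeRing; sum; zero)
  open CommutativeRing (RealNumbers.commutativeRing ℝ) public
    using (ring; semiring)
  open RingProperties ring public
    using (-‿distribˡ-*; -‿distribʳ-*; -‿involutive; -‿+-comm; -0#≈0#; x∙y⁻¹≈ε⇒x≈y; x≈y⇒x∙y⁻¹≈ε)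
  open SemiringSum semiring public
    using (sum; sum-cong-≋; ∑-distrib-+; ∑-comm; *-distribˡ-sum; *-distribʳ-sum;
           sum-replicate-zero)
  open SetoidReasoning setoid public

  private
    -- In the optimised multiple, one times `1#` reduces to `1#` itself, so `con (+ 1)` in a solver
    -- equation agrees with `1#` by `refl`.
    module ×′ = SemiringMultOptimised semiring

    ⟦_⟧ℤ : ℤ → Carrier
    ⟦ + n      ⟧ℤ = n ×′.× 1#
    ⟦ -[1+ n ] ⟧ℤ = - (suc n ×′.× 1#)

    -homo : ∀ i → ⟦ ℤ.- i ⟧ℤ ≈ - ⟦ i ⟧ℤ
    -homo (+ zero)  = sym -0#≈0#
    -homo (+ suc n) = refl
    -homo -[1+ n ]  = sym (-‿involutive _)

    ⊖-homo : ∀ m n → ⟦ m ⊖ n ⟧ℤ ≈ m ×′.× 1# - n ×′.× 1#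
    ⊖-homo m       zero    = trans (sym (+-identityʳ _)) (+-congˡ (sym -0#≈0#))
    ⊖-homo zero    (suc n) = sym (+-identityˡ _)
    ⊖-homo (suc m) (suc n) = begin
      ⟦ suc m ⊖ suc n ⟧ℤ                    ≡⟨ ≡.cong ⟦_⟧ℤ (ℤ.[1+m]⊖[1+n]≡m⊖n m n) ⟩
      ⟦ m ⊖ n ⟧ℤ                            ≈⟨ ⊖-homo m n ⟩
      M - N                                 ≈⟨ +-congʳ (+-identityʳ M) ⟨
      (M + 0#) - N                          ≈⟨ +-congʳ (+-congˡ (-‿inverseʳ 1#)) ⟨
      (M + (1# - 1#)) - N                   ≈⟨ +-congʳ (+-assoc M 1# (- 1#)) ⟨
      ((M + 1#) - 1#) - N                   ≈⟨ +-assoc _ _ _ ⟩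
      (M + 1#) + (- 1# - N)                 ≈⟨ +-congˡ (-‿+-comm 1# N) ⟩
      (M + 1#) - (1# + N)                   ≈⟨ +-congʳ (+-comm M 1#) ⟩
      (1# + M) - (1# + N)                   ≈⟨ +-cong (×′.×-homo-+ 1# 1 m) (-‿cong (×′.×-homo-+ 1# 1 n)) ⟨
      (suc m ×′.× 1#) - (suc n ×′.× 1#)     ∎
      where
      M = m ×′.× 1#
      N = n ×′.× 1#

    +-homo : ∀ i j → ⟦ i ℤ.+ j ⟧ℤ ≈ ⟦ i ⟧ℤ + ⟦ j ⟧ℤ
    +-homo (+ m)    (+ n)    = ×′.×-homo-+ 1# m n
    +-homo (+ m)    -[1+ n ] = ⊖-homo m (suc n)
    +-homo -[1+ m ] (+ n)    = trans (⊖-homo n (suc m)) (+-comm _ _)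
    +-homo -[1+ m ] -[1+ n ] = begin
      - (suc (suc (m ℕ.+ n)) ×′.× 1#)   ≡⟨ ≡.cong (λ l → - (suc l ×′.× 1#)) (≡.sym (ℕ.+-suc m n)) ⟩
      - ((suc m ℕ.+ suc n) ×′.× 1#)     ≈⟨ -‿cong (×′.×-homo-+ 1# (suc m) (suc n)) ⟩
      - (suc m ×′.× 1# + suc n ×′.× 1#) ≈⟨ -‿+-comm _ _ ⟨
      - (suc m ×′.× 1#) - suc n ×′.× 1# ∎

    *-homo⁺ : ∀ m j → ⟦ + m ℤ.* j ⟧ℤ ≈ ⟦ + m ⟧ℤ * ⟦ j ⟧ℤ
    *-homo⁺ m (+ n) = trans (reflexive (≡.cong ⟦_⟧ℤ (≡.sym (ℤ.pos-* m n)))) (×′.×1-homo-* m n)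
    *-homo⁺ m -[1+ n ] = begin
      ⟦ + m ℤ.* -[1+ n ] ⟧ℤ         ≡⟨ ≡.cong ⟦_⟧ℤ (ℤ.neg-distribʳ-* (+ m) (+ suc n)) ⟨
      ⟦ ℤ.- (+ m ℤ.* + suc n) ⟧ℤ    ≈⟨ -homo (+ m ℤ.* + suc n) ⟩
      - ⟦ + m ℤ.* + suc n ⟧ℤ        ≈⟨ -‿cong (*-homo⁺ m (+ suc n)) ⟩
      - (⟦ + m ⟧ℤ * ⟦ + suc n ⟧ℤ)   ≈⟨ -‿distribʳ-* _ _ ⟩
      ⟦ + m ⟧ℤ * ⟦ -[1+ n ] ⟧ℤ      ∎

    *-homo : ∀ i j → ⟦ i ℤ.* j ⟧ℤ ≈ ⟦ i ⟧ℤ * ⟦ j ⟧ℤ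
    *-homo (+ m)    j = *-homo⁺ m j
    *-homo -[1+ m ] j = begin
      ⟦ -[1+ m ] ℤ.* j ⟧ℤ           ≡⟨ ≡.cong ⟦_⟧ℤ (ℤ.neg-distribˡ-* (+ suc m) j) ⟨
      ⟦ ℤ.- (+ suc m ℤ.* j) ⟧ℤ      ≈⟨ -homo (+ suc m ℤ.* j) ⟩
      - ⟦ + suc m ℤ.* j ⟧ℤ          ≈⟨ -‿cong (*-homo⁺ (suc m) j) ⟩
      - (⟦ + suc m ⟧ℤ * ⟦ j ⟧ℤ)     ≈⟨ -‿distribˡ-* _ _ ⟩
      ⟦ -[1+ m ] ⟧ℤ * ⟦ j ⟧ℤ        ∎

    ℤ-morphism : ℤ.+-*-rawRing -Raw-AlmostCommutative⟶ fromCommutativeRing (RealNumbers.commutativeRing ℝ)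
    ℤ-morphism = record
      { ⟦_⟧    = ⟦_⟧ℤ
      ; +-homo = +-homo
      ; *-homo = *-homo
      ; -‿homo = -homo
      ; 0-homo = refl
      ; 1-homo = refl
      }

  -- Equality of reals is undecidable, so the coefficients are taken from ℤ, where the normaliser
  -- can recognise cancellation.
  module Solver = RingSolver ℤ.+-*-rawRing (fromCommutativeRing (RealNumbers.commutativeRing ℝ)) ℤ-morphism
    (λ i j → Maybe.map (λ i≡j → reflexive (≡.cong ⟦_⟧ℤ i≡j)) (dec⇒maybe (i ℤ.≟ j)))
  open Solver public using (solve; _:=_; _:+_; _:*_; _:-_; :-_; con)

  abstract
    #0⇒inverse : ∀ {x} → x # 0# → ∃[ y ] y * x ≈ 1#
    #0⇒inverse x#0 with y , yx≈1 , _ ← #⇒invertible x#0 =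
      y , trans (*-congˡ (trans (sym (+-identityʳ _)) (+-congˡ (sym -0#≈0#)))) yx≈1

  *-cancel-#0 : ∀ {x y z} → x # 0# → x * y ≈ x * z → y ≈ z
  *-cancel-#0 {x} {y} {z} x#0 xy≈xz with i , ix≈1 ← #0⇒inverse x#0 = begin
    y           ≈⟨ *-identityˡ y ⟨
    1# * y      ≈⟨ *-congʳ ix≈1 ⟨
    i * x * y   ≈⟨ *-assoc i x y ⟩
    i * (x * y) ≈⟨ *-congˡ xy≈xz ⟩
    i * (x * z) ≈⟨ *-assoc i x z ⟨
    i * x * z   ≈⟨ *-congʳ ix≈1 ⟩
    1# * z      ≈⟨ *-identityˡ z ⟩
    z           ∎

  *≈0⇒≈0 : ∀ {x y} → x # 0# → x * y ≈ 0# → y ≈ 0#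
  *≈0⇒≈0 x#0 xy≈0 = *-cancel-#0 x#0 (trans xy≈0 (sym (zeroʳ _)))

  -≈0⇒≈ : ∀ {x y} → x - y ≈ 0# → x ≈ y
  -≈0⇒≈ = x∙y⁻¹≈ε⇒x≈y _ _

  ≈⇒-≈0 : ∀ {x y} → x ≈ y → x - y ≈ 0#
  ≈⇒-≈0 = x≈y⇒x∙y⁻¹≈ε

  ¬#⇒≈ : ∀ {x y} → ¬ (x # y) → x ≈ y
  ¬#⇒≈ = proj₁ (tight _ _)

  >0⇒#0 : ∀ {x} → 0# < x → x # 0#
  >0⇒#0 0<x = Equivalence.from #⇔<⊎> (inj₂ 0<x)

  <-resp : ∀ {x x′ y y′} → x ≈ x′ → y ≈ y′ → x < y → x′ < y′
  <-resp x≈x′ y≈y′ = <.<-respˡ-≈ x≈x′ ∘ <.<-respʳ-≈ y≈y′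

  #-resp : ∀ {x x′ y y′} → x ≈ x′ → y ≈ y′ → x # y → x′ # y′
  #-resp x≈x′ y≈y′ x#y with Equivalence.to #⇔<⊎> x#y
  ... | inj₁ x<y = Equivalence.from #⇔<⊎> (inj₁ (<-resp x≈x′ y≈y′ x<y))
  ... | inj₂ y<x = Equivalence.from #⇔<⊎> (inj₂ (<-resp y≈y′ x≈x′ y<x))

  inverse⇒#0 : ∀ {x y} → y * x ≈ 1# → x # 0#
  inverse⇒#0 {x} {y} yx≈1 = invertible⇒# (y , left , trans (*-comm _ _) left)
    where
    left : y * (x - 0#) ≈ 1#
    left = trans (solve 2 (λ y x → y :* (x :- con (+ 0)) := y :* x) refl y x) yx≈1

  #0⇒product#0 : ∀ {x y} → x # 0# → y # 0# → (x * y) # 0#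
  #0⇒product#0 {x} {y} x#0 y#0
    with i , ix≈1 ← #0⇒inverse x#0 | j , jy≈1 ← #0⇒inverse y#0 = inverse⇒#0 (begin
    i * j * (x * y)   ≈⟨ solve 4 (λ i j x y → i :* j :* (x :* y) := (i :* x) :* (j :* y)) refl i j x y ⟩
    i * x * (j * y)   ≈⟨ *-cong ix≈1 jy≈1 ⟩
    1# * 1#           ≈⟨ *-identityˡ 1# ⟩
    1#                ∎)

  product#0⇒#0ʳ : ∀ {x y} → (x * y) # 0# → y # 0#
  product#0⇒#0ʳ {x} {y} xy#0 with i , ixy≈1 ← #0⇒inverse xy#0 =
    inverse⇒#0 (trans (*-assoc i x y) ixy≈1)

  -#0⇒# : ∀ {x y} → (x - y) # 0# → x # y
  -#0⇒# x-y#0 with i , inverse ← #0⇒inverse x-y#0 = invertible⇒# (i , inverse , trans (*-comm _ _) inverse)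

  <-cotrans : ∀ {x y} → x < y → ∀ z → x < z ⊎ z < y
  <-cotrans x<y z with #-cotrans (Equivalence.from #⇔<⊎> (inj₁ x<y)) z
  ... | inj₁ x#z with Equivalence.to #⇔<⊎> x#z
  ...   | inj₁ x<z = inj₁ x<z
  ...   | inj₂ z<x = inj₂ (<.trans z<x x<y)
  <-cotrans x<y z | inj₂ z#y with Equivalence.to #⇔<⊎> z#y
  ...   | inj₁ z<y = inj₂ z<y
  ...   | inj₂ y<z = inj₁ (<.trans x<y y<z)

  <⇒0<- : ∀ {x y} → x < y → 0# < y - x
  <⇒0<- {x} x<y = <-resp (-‿inverseʳ x) refl (+-monoˡ-< (- x) x<y)

  0<-⇒< : ∀ {x y} → 0# < y - x → x < y
  0<-⇒< {x} {y} 0<y-x = <-resp (+-identityˡ x)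
    (solve 2 (λ x y → y :- x :+ x := y) refl x y) (+-monoˡ-< x 0<y-x)

  <0⇒0<- : ∀ {x} → x < 0# → 0# < - x
  <0⇒0<- x<0 = <-resp refl (+-identityˡ _) (<⇒0<- x<0)

  infix 4 _≥0
  -- Nonnegativity is the refutation of a strict inequality. In this form it holds for squares and
  -- passes to sums without deciding signs, and tightness of the apartness turns it into equations.
  _≥0 : Carrier → Set ℓ₂
  x ≥0 = ¬ (x < 0#)

  >0⇒≥0 : ∀ {x} → 0# < x → x ≥0
  >0⇒≥0 0<x x<0 = <.irrefl refl (<.trans 0<x x<0)

  ≥0-resp-≈ : ∀ {x y} → x ≈ y → x ≥0 → y ≥0
  ≥0-resp-≈ x≈y x≥0 y<0 = x≥0 (<-resp (sym x≈y) refl y<0)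

  -- Cotransitivity places `y` against the pair `x + y < 0#`, which stands in for a case distinction
  -- on signs.
  +-≥0 : ∀ {x y} → x ≥0 → y ≥0 → x + y ≥0
  +-≥0 {x} {y} x≥0 y≥0 x+y<0 with <-cotrans x+y<0 y
  ... | inj₂ y<0   = y≥0 y<0
  ... | inj₁ x+y<y = x≥0 (<-resp (solve 2 (λ x y → x :+ y :- y := x) refl x y)
                           (-‿inverseʳ y) (+-monoˡ-< (- y) x+y<y))

  >0-+-≥0 : ∀ {x y} → 0# < x → y ≥0 → 0# < x + y
  >0-+-≥0 {x} {y} 0<x y≥0 with <-cotrans (<-resp (+-identityˡ _) (-‿inverseʳ x) (+-monoˡ-< (- x) 0<x)) y
  ... | inj₁ -x<y = <-resp (-‿inverseˡ x) (+-comm y x) (+-monoˡ-< x -x<y)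
  ... | inj₂ y<0  = contradiction y<0 y≥0

  *-pos-neg : ∀ {x y} → 0# < x → y < 0# → x * y < 0#
  *-pos-neg {x} {y} 0<x y<0 = 0<-⇒< (<-resp refl
    (solve 2 (λ x y → x :* (:- y) := con (+ 0) :- x :* y) refl x y)
    (*-pos 0<x (<0⇒0<- y<0)))

  *-cancel-≥0 : ∀ {x y} → 0# < x → x * y ≥0 → y ≥0
  *-cancel-≥0 0<x xy≥0 y<0 = xy≥0 (*-pos-neg 0<x y<0)

  *-cancel->0 : ∀ {x y} → 0# < x → 0# < x * y → 0# < y
  *-cancel->0 {x} {y} 0<x 0<xy with Equivalence.to #⇔<⊎> (product#0⇒#0ʳ (>0⇒#0 0<xy))
  ... | inj₁ y<0 = contradiction (<.trans 0<xy (*-pos-neg 0<x y<0)) (<.irrefl refl)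
  ... | inj₂ 0<y = 0<y

  #0⇒square>0 : ∀ {x} → x # 0# → 0# < x * x
  #0⇒square>0 {x} x#0 with Equivalence.to #⇔<⊎> x#0
  ... | inj₁ x<0 = <-resp refl (solve 1 (λ x → (:- x) :* (:- x) := x :* x) refl x)
                     (*-pos (<0⇒0<- x<0) (<0⇒0<- x<0))
  ... | inj₂ 0<x = *-pos 0<x 0<x

  square≥0 : ∀ x → x * x ≥0
  square≥0 x x²<0 = <.irrefl (trans (*-congˡ x≈0) (zeroʳ x)) x²<0
    where
    x≈0 : x ≈ 0#
    x≈0 = ¬#⇒≈ λ x#0 → >0⇒≥0 (#0⇒square>0 x#0) x²<0

  square≈0⇒≈0 : ∀ {x} → x * x ≈ 0# → x ≈ 0#
  square≈0⇒≈0 x²≈0 = ¬#⇒≈ λ x#0 → <.irrefl (sym x²≈0) (#0⇒square>0 x#0)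

  ≥0-+-≈0 : ∀ {x y} → x ≥0 → y ≥0 → x + y ≈ 0# → x ≈ 0#
  ≥0-+-≈0 {x} {y} x≥0 y≥0 x+y≈0 = ¬#⇒≈ λ x#0 →
    [ x≥0 , (λ 0<x → <.irrefl (sym x+y≈0) (>0-+-≥0 0<x y≥0)) ]′ (Equivalence.to #⇔<⊎> x#0)

  sum-cong : ∀ {n} {f g : Vector Carrier n} → (∀ i → f i ≈ g i) → sum f ≈ sum g
  sum-cong = sum-cong-≋

  sum≥0 : ∀ {n} {f : Vector Carrier n} → (∀ i → f i ≥0) → sum f ≥0
  sum≥0 {zero}  _   = <.irrefl refl
  sum≥0 {suc n} f≥0 = +-≥0 (f≥0 zero) (sum≥0 (f≥0 ∘ suc))

  sum≈0⇒≈0 : ∀ {n} {f : Vector Carrier n} → (∀ i → f i ≥0) → sum f ≈ 0# → ∀ i → f i ≈ 0#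
  sum≈0⇒≈0 f≥0 Σf≈0 zero    = ≥0-+-≈0 (f≥0 zero) (sum≥0 (f≥0 ∘ suc)) Σf≈0
  sum≈0⇒≈0 f≥0 Σf≈0 (suc i) = sum≈0⇒≈0 (f≥0 ∘ suc)
    (≥0-+-≈0 (sum≥0 (f≥0 ∘ suc)) (f≥0 zero) (trans (+-comm _ _) Σf≈0)) i

  sum>0 : ∀ {n} {f : Vector Carrier n} → (∀ i → f i ≥0) → ∀ i → 0# < f i → 0# < sum f
  sum>0 f≥0 zero    0<fi = >0-+-≥0 0<fi (sum≥0 (f≥0 ∘ suc))
  sum>0 f≥0 (suc i) 0<fi = <-resp refl (+-comm _ _) (>0-+-≥0 (sum>0 (f≥0 ∘ suc) i 0<fi) (f≥0 zero))

  sum-0 : ∀ {n} {f : Vector Carrier n} → (∀ i → f i ≈ 0#) → sum f ≈ 0#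
  sum-0 {n} f≈0 = trans (sum-cong f≈0) (sum-replicate-zero n)

  sum-const : ∀ {n} (x : Carrier) → sum {n} (λ _ → x) ≈ fromℕ n * x
  sum-const {zero}  x = sym (zeroˡ x)
  sum-const {suc n} x = trans (+-cong (sym (*-identityˡ x)) (sum-const {n} x)) (sym (distribʳ x 1# (fromℕ n)))

  sum-- : ∀ {n} (f g : Vector Carrier n) → sum (λ i → f i - g i) ≈ sum f - sum g
  sum-- f g = begin
    sum (λ i → f i - g i)       ≈⟨ ∑-distrib-+ f (λ i → - g i) ⟩
    sum f + sum (λ i → - g i)   ≈⟨ +-congˡ (sum-cong (λ i → solve 1 (λ x → :- x := :- con (+ 1) :* x) refl (g i))) ⟩
    sum f + sum (λ i → - 1# * g i) ≈⟨ +-congˡ (*-distribˡ-sum (- 1#) g) ⟨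
    sum f + - 1# * sum g        ≈⟨ solve 2 (λ x y → x :+ (:- con (+ 1)) :* y := x :- y) refl (sum f) (sum g) ⟩
    sum f - sum g               ∎

  sum-single : ∀ {n} {f : Vector Carrier n} i → (∀ j → j ≢ i → f j ≈ 0#) → sum f ≈ f i
  sum-single zero    f≈0 = trans (+-congˡ (sum-0 (λ j → f≈0 (suc j) λ ()))) (+-identityʳ _)
  sum-single (suc i) f≈0 = trans (+-cong (f≈0 zero λ ())
    (sum-single i (λ j j≢i → f≈0 (suc j) (j≢i ∘ Fin.suc-injective)))) (+-identityˡ _)

  fromℕ-homo-+ : ∀ m n → fromℕ (m ℕ.+ n) ≈ fromℕ m + fromℕ n
  fromℕ-homo-+ = SemiringMult.×-homo-+ semiring 1#

  fromℕ-homo-* : ∀ m n → fromℕ (m ℕ.* n) ≈ fromℕ m * fromℕ n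
  fromℕ-homo-* = SemiringMult.×1-homo-* semiring

  fromℕ>0 : ∀ {m} → Fin m → 0# < fromℕ m
  fromℕ>0 {suc m} _ = fromℕ-positive m

  ≢0⇒fromℕ>0 : ∀ {m} → m ≢ 0 → 0# < fromℕ m
  ≢0⇒fromℕ>0 {zero}  0≢0 = contradiction ≡.refl 0≢0
  ≢0⇒fromℕ>0 {suc m} _   = fromℕ-positive m

  +-≈0 : ∀ {x y} → x ≈ 0# → y ≈ 0# → x + y ≈ 0#
  +-≈0 x≈0 y≈0 = trans (+-cong x≈0 y≈0) (+-identityˡ 0#)

  *-≈0 : ∀ x {y} → y ≈ 0# → x * y ≈ 0#
  *-≈0 x y≈0 = trans (*-congˡ y≈0) (zeroʳ x)

-- Graph distance as the length of a shortest walk.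

module Distance {n : ℕ} (Γ : Graph n) (connected : ∀ x y → ∃[ l ] Walk Γ x y l) where
  open Graph Γ

  snoc : ∀ {x y z l} → Walk Γ x y l → y ~ z → Walk Γ x z (suc l)
  snoc stop       y~z = step y~z stop
  snoc (step e w) y~z = step e (snoc w y~z)

  reverse : ∀ {x y l} → Walk Γ x y l → Walk Γ y x l
  reverse stop       = stop
  reverse (step e w) = snoc (reverse w) (~-sym e)

  walk? : ∀ x y l → Dec (Walk Γ x y l)
  walk? x y zero    = map′ (λ { ≡.refl → stop }) (λ { stop → ≡.refl }) (x Fin.≟ y)
  walk? x y (suc l) = map′ (λ (z , x~z , w) → step x~z w) (λ { (step x~z w) → _ , x~z , w })
    (Fin.any? (λ z → (x ~? z) ×-dec walk? z y l))

  shortest : ∀ {x y} l → Walk Γ x y l → ∃[ d ] Dist Γ x y d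
  shortest {x} {y} = ℕ.<-rec _ λ l shorter w → case-shorter l shorter w (ℕ.anyUpTo? (walk? x y) l)
    where
    case-shorter : ∀ l → (∀ {m} → m ℕ.< l → Walk Γ x y m → ∃[ d ] Dist Γ x y d) →
                   Walk Γ x y l → Dec (∃[ m ] (m ℕ.< l × Walk Γ x y m)) → ∃[ d ] Dist Γ x y d
    case-shorter l shorter w (yes (m , m<l , w′)) = shorter m<l w′
    case-shorter l shorter w (no none)            =
      l , w , λ w′ → ℕ.≮⇒≥ λ m<l → none (_ , m<l , w′)

  dist : Fin n → Fin n → ℕ
  dist x y = proj₁ (shortest _ (proj₂ (connected x y)))

  dist-Dist : ∀ x y → Dist Γ x y (dist x y)
  dist-Dist x y = proj₂ (shortest _ (proj₂ (connected x y)))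

  dist≤ : ∀ {x y l} → Walk Γ x y l → dist x y ℕ.≤ l
  dist≤ {x} {y} = proj₂ (dist-Dist x y)

  Dist⇒≡ : ∀ {x y i} → Dist Γ x y i → dist x y ≡ i
  Dist⇒≡ {x} {y} (w , least) = ℕ.≤-antisym (dist≤ w) (least (proj₁ (dist-Dist x y)))

  ≡⇒Dist : ∀ {x y i} → dist x y ≡ i → Dist Γ x y i
  ≡⇒Dist {x} {y} ≡.refl = dist-Dist x y

  dist-sym : ∀ x y → dist x y ≡ dist y x
  dist-sym x y = ℕ.≤-antisym (dist≤ (reverse (proj₁ (dist-Dist y x)))) (dist≤ (reverse (proj₁ (dist-Dist x y))))

  dist-refl : ∀ x → dist x x ≡ 0
  dist-refl x = ℕ.n≤0⇒n≡0 (dist≤ stop)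

  dist≡0 : ∀ {x y} → dist x y ≡ 0 → x ≡ y
  dist≡0 {x} {y} eq with stop ← proj₁ (≡⇒Dist {x} {y} eq) = ≡.refl

  ~⇒dist≡1 : ∀ {x y} → x ~ y → dist x y ≡ 1
  ~⇒dist≡1 {x} {y} x~y = ℕ.≤-antisym (dist≤ (step x~y stop))
    (ℕ.n≢0⇒n>0 λ eq → ~-irrefl (dist≡0 eq) x~y)

  dist≡1⇒~ : ∀ {x y} → dist x y ≡ 1 → x ~ y
  dist≡1⇒~ {x} {y} eq with step x~y stop ← proj₁ (≡⇒Dist {x} {y} eq) = x~y

  dist-step : ∀ y {x z} → x ~ z → dist y z ℕ.≤ suc (dist y x)
  dist-step y x~z = dist≤ (snoc (proj₁ (dist-Dist y _)) x~z)

  closer-neighbour : ∀ {x y i} → dist y x ≡ suc i → ∃[ z ] (x ~ z × dist y z ≡ i)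
  closer-neighbour {x} {y} {i} eq
    with step {y = z} x~z w ← reverse (proj₁ (≡⇒Dist {y} {x} eq)) =
    z , x~z , ℕ.≤-antisym (dist≤ (reverse w))
      (ℕ.s≤s⁻¹ (≡.subst (ℕ._≤ suc (dist y z)) eq (dist-step y (~-sym x~z))))

Exactly⇒≢0 : ∀ {n m} {P : Pred (Fin n) _} {z} → Exactly m P → P z → m ≢ 0
Exactly⇒≢0 (S , S⇔P , ≡.refl) Pz eq =
  ℕ.m<n⇒n≢0 (x∈p⇒∣p-x∣<∣p∣ (Equivalence.from (S⇔P _) Pz)) eq

-- The Bose-Mesner algebra of a distance-regular graph.

module DistanceRegular {ℓ ℓ₁ ℓ₂ : Level} (ℝ : RealNumbers ℓ ℓ₁ ℓ₂) {n D : ℕ} (Γ : Graph n)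
  (b c : ℕ → ℕ) (distanceRegular : IsDistanceRegular Γ D b c) where

  open RealProperties ℝ
  open Spectral ℝ using (Matrix; adjacencyMatrix; _*ᵥ_; ⟨_,_⟩; Eigenspace; IsEigenvalue;
                         IsOrthogonalProjection; DistinctEigenvalues)
  open Graph Γ
  open IsDistanceRegular distanceRegular
  open Distance Γ connected public

  private
    A : Matrix n
    A = adjacencyMatrix Γ

    k : Carrier
    k = fromℕ (b 0)

  Sequence : Set ℓ
  Sequence = ℕ → Carrier

  -- The general element of the Bose-Mesner algebra: the combination of the distance-`i` matrices
  -- with coefficients `φ i`. Values of `φ` at distances that do not occur are irrelevant.
  Φ : Sequence → Matrix n
  Φ φ y x = φ (dist y x)

  -- With aᵢ = k - bᵢ - cᵢ this is cᵢ φᵢ₋₁ + aᵢ φᵢ + bᵢ φᵢ₊₁; the junk value φ₀₋₁ = φ₀ is harmless.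
  B : Sequence → Sequence
  B φ i = k * φ i + (fromℕ (c i) * (φ (ℕ.pred i) - φ i) + fromℕ (b i) * (φ (suc i) - φ i))

  private
    ind : Bool → Carrier
    ind p = if p then 1# else 0#

  sum-subset : ∀ {m} (S : Subset m) u → sum (λ z → ind (lookup S z) * u) ≈ fromℕ ∣ S ∣ * u
  sum-subset []          u = sym (zeroˡ u)
  sum-subset (true ∷ S)  u = trans (+-cong (*-identityˡ u) (sum-subset S u))
    (solve 2 (λ u m → u :+ m :* u := (con (+ 1) :+ m) :* u) refl u (fromℕ ∣ S ∣))
  sum-subset (false ∷ S) u = trans (+-cong (zeroˡ u) (sum-subset S u)) (+-identityˡ _)

  ∈⇒lookup : ∀ {m} {S : Subset m} {z} → z ∈ S → lookup S z ≡ true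
  ∈⇒lookup = []=⇒lookup

  lookup⇒∈ : ∀ {m} {S : Subset m} {z} → lookup S z ≡ true → z ∈ S
  lookup⇒∈ {S = S} {z} = lookup⇒[]= z S

  A-~ : ∀ {x y} → x ~ y → A x y ≈ 1#
  A-~ {x} {y} x~y = reflexive (≡.cong ind (dec-true (x ~? y) x~y))

  A-≁ : ∀ {x y} → ¬ (x ~ y) → A x y ≈ 0#
  A-≁ {x} {y} x≁y = reflexive (≡.cong ind (dec-false (x ~? y) x≁y))

  A-sym : ∀ x y → A x y ≈ A y x
  A-sym x y = reflexive (≡.cong ind (does-⇔ (mk⇔ ~-sym ~-sym) (x ~? y) (y ~? x)))

  sum-A : ∀ x → sum (A x) ≈ k
  sum-A x with S , S⇔ , ∣S∣≡b₀ ← b-count (≡⇒Dist (dist-refl x)) = begin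
    sum (A x)                          ≈⟨ sum-cong pointwise ⟩
    sum (λ z → ind (lookup S z) * 1#)  ≈⟨ sum-subset S 1# ⟩
    fromℕ ∣ S ∣ * 1#                   ≈⟨ *-identityʳ _ ⟩
    fromℕ ∣ S ∣                        ≡⟨ ≡.cong fromℕ ∣S∣≡b₀ ⟩
    k                                  ∎
    where
    pointwise : ∀ z → A x z ≈ ind (lookup S z) * 1#
    pointwise z with lookup S z in eq
    ... | true  = trans (A-~ (proj₁ (Equivalence.to (S⇔ z) (lookup⇒∈ eq)))) (sym (*-identityʳ 1#))
    ... | false = trans (A-≁ λ x~z → contradiction
                    (≡.trans (≡.sym eq) (∈⇒lookup (Equivalence.from (S⇔ z) (x~z , ≡⇒Dist (~⇒dist≡1 x~z))))) λ ())
                    (sym (zeroˡ 1#))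

  -- Once `φ i` is subtracted from the value at every neighbour of `x`, only the neighbours counted
  -- by `c i` and `b i` contribute; those at the same distance from `y` never have to be counted.
  A*Φ : ∀ φ y x → (A *ᵥ Φ φ y) x ≈ Φ (B φ) y x
  A*Φ φ y x = begin
    sum (λ z → A x z * φ (dist y z))
      ≈⟨ sum-cong (λ z → solve 3 (λ a p q → a :* p := a :* q :+ a :* (p :- q)) refl (A x z) (φ (dist y z)) φᵢ) ⟩
    sum (λ z → A x z * φᵢ + A x z * (φ (dist y z) - φᵢ))
      ≈⟨ ∑-distrib-+ (λ z → A x z * φᵢ) (λ z → A x z * (φ (dist y z) - φᵢ)) ⟩
    sum (λ z → A x z * φᵢ) + sum (λ z → A x z * (φ (dist y z) - φᵢ))
      ≈⟨ +-cong (trans (sym (*-distribʳ-sum φᵢ (A x))) (*-congʳ (sum-A x))) (sum-cong pointwise) ⟩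
    k * φᵢ + sum (λ z → ind (lookup C z) * u + ind (lookup U z) * v)
      ≈⟨ +-congˡ (∑-distrib-+ (λ z → ind (lookup C z) * u) (λ z → ind (lookup U z) * v)) ⟩
    k * φᵢ + (sum (λ z → ind (lookup C z) * u) + sum (λ z → ind (lookup U z) * v))
      ≈⟨ +-congˡ (+-cong (trans (sum-subset C u) (*-congʳ (reflexive (≡.cong fromℕ ∣C∣))))
                         (trans (sum-subset U v) (*-congʳ (reflexive (≡.cong fromℕ ∣U∣))))) ⟩
    B φ i ∎
    where
    i = dist y x
    φᵢ = φ i
    u = φ (ℕ.pred i) - φᵢ
    v = φ (suc i) - φᵢ
    closer = c-count (dist-Dist y x)
    further = b-count (dist-Dist y x)
    C = proj₁ closer
    C⇔ = proj₁ (proj₂ closer)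
    ∣C∣ = proj₂ (proj₂ closer)
    U = proj₁ further
    U⇔ = proj₁ (proj₂ further)
    ∣U∣ = proj₂ (proj₂ further)

    same : ∀ {z} → x ~ z → lookup C z ≡ false → lookup U z ≡ false → dist y z ≡ i
    same {z} x~z z∉C z∉U with ℕ.<-cmp (dist y z) i
    ... | tri≈ _ eq _ = eq
    ... | tri> _ _ i<d = contradiction (≡.trans (≡.sym z∉U) (∈⇒lookup (Equivalence.from (U⇔ z)
            (x~z , ≡⇒Dist (ℕ.≤-antisym (dist-step y x~z) i<d))))) λ ()
    ... | tri< d<i _ _ = contradiction (≡.trans (≡.sym z∉C) (∈⇒lookup (Equivalence.from (C⇔ z)
            (x~z , dist y z , ℕ.≤-antisym (dist-step y (~-sym x~z)) d<i , dist-Dist y z)))) λ ()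

    pointwise : ∀ z → A x z * (φ (dist y z) - φᵢ) ≈ ind (lookup C z) * u + ind (lookup U z) * v
    pointwise z with lookup C z in z∈C | lookup U z in z∈U
    ... | true | true with _ , j , i≡1+j , z-closer ← Equivalence.to (C⇔ z) (lookup⇒∈ z∈C)
                          | _ , z-further ← Equivalence.to (U⇔ z) (lookup⇒∈ z∈U) =
      contradiction (≡.trans i≡1+j (≡.cong suc (≡.trans (≡.sym (Dist⇒≡ z-closer)) (Dist⇒≡ z-further))))
        (ℕ.<⇒≢ (ℕ.m≤n⇒m≤1+n (ℕ.n<1+n i)))
    ... | true | false with x~z , j , i≡1+j , z-closer ← Equivalence.to (C⇔ z) (lookup⇒∈ z∈C) = begin
      A x z * (φ (dist y z) - φᵢ)
        ≈⟨ *-cong (A-~ x~z) (+-congʳ (reflexive (≡.cong φ (≡.trans (Dist⇒≡ z-closer) (≡.sym (≡.cong ℕ.pred i≡1+j)))))) ⟩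
      1# * u             ≈⟨ solve 2 (λ u v → con (+ 1) :* u := con (+ 1) :* u :+ con (+ 0) :* v) refl u v ⟩
      1# * u + 0# * v    ∎
    ... | false | true with x~z , z-further ← Equivalence.to (U⇔ z) (lookup⇒∈ z∈U) = begin
      A x z * (φ (dist y z) - φᵢ)
        ≈⟨ *-cong (A-~ x~z) (+-congʳ (reflexive (≡.cong φ (Dist⇒≡ z-further)))) ⟩
      1# * v             ≈⟨ solve 2 (λ u v → con (+ 1) :* v := con (+ 0) :* u :+ con (+ 1) :* v) refl u v ⟩
      0# * u + 1# * v    ∎
    ... | false | false = trans vanishes
            (solve 2 (λ u v → con (+ 0) := con (+ 0) :* u :+ con (+ 0) :* v) refl u v)
      where
      vanishes : A x z * (φ (dist y z) - φᵢ) ≈ 0#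
      vanishes with x ~? z
      ... | no  x≁z = zeroˡ _
      ... | yes x~z = trans (*-congˡ (≈⇒-≈0 (reflexive (≡.cong φ (same x~z z∈C z∈U))))) (zeroʳ _)

  ⟨,⟩-cong : ∀ {u u′ v v′ : Vector Carrier n} → (∀ x → u x ≈ u′ x) → (∀ x → v x ≈ v′ x) →
             ⟨ u , v ⟩ ≈ ⟨ u′ , v′ ⟩
  ⟨,⟩-cong u≈u′ v≈v′ = sum-cong λ x → *-cong (u≈u′ x) (v≈v′ x)

  A-self-adjoint : ∀ u v → ⟨ A *ᵥ u , v ⟩ ≈ ⟨ u , A *ᵥ v ⟩
  A-self-adjoint u v = begin
    sum (λ x → sum (λ y → A x y * u y) * v x)
      ≈⟨ sum-cong (λ x → *-distribʳ-sum (v x) (λ y → A x y * u y)) ⟩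
    sum (λ x → sum (λ y → A x y * u y * v x))
      ≈⟨ ∑-comm (λ x y → A x y * u y * v x) ⟩
    sum (λ y → sum (λ x → A x y * u y * v x))
      ≈⟨ sum-cong (λ y → sum-cong (λ x → trans (*-congʳ (*-congʳ (A-sym x y)))
           (solve 3 (λ a u v → a :* u :* v := u :* (a :* v)) refl (A y x) (u y) (v x)))) ⟩
    sum (λ y → sum (λ x → u y * (A y x * v x)))
      ≈⟨ sum-cong (λ y → *-distribˡ-sum (u y) (λ x → A y x * v x)) ⟨
    sum (λ y → u y * sum (λ x → A y x * v x)) ∎

  *ᵥ-cong : ∀ {u v : Vector Carrier n} → (∀ x → u x ≈ v x) → ∀ x → (A *ᵥ u) x ≈ (A *ᵥ v) x
  *ᵥ-cong u≈v x = sum-cong λ y → *-congˡ (u≈v y)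

  *ᵥ-scale : ∀ r u x → (A *ᵥ (λ y → r * u y)) x ≈ r * (A *ᵥ u) x
  *ᵥ-scale r u x = trans
    (sum-cong λ y → solve 3 (λ a r u → a :* (r :* u) := r :* (a :* u)) refl (A x y) r (u y))
    (sym (*-distribˡ-sum r (λ y → A x y * u y)))

  -- Elements of the algebra as polynomials in the adjacency matrix.

  infixr 8 _⊙_ X·_
  infixl 7 _⊕_
  -- Kept as syntax so that one polynomial can act through `A` on vectors, through `B` on sequences,
  -- and as a scalar on eigenvectors.
  data Polynomial : Set ℓ where
    one  : Polynomial
    _⊕_  : Polynomial → Polynomial → Polynomial
    _⊙_  : Carrier → Polynomial → Polynomial
    X·_  : Polynomial → Polynomial

  eval : Polynomial → Carrier → Carrier
  eval one     μ = 1#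
  eval (p ⊕ q) μ = eval p μ + eval q μ
  eval (r ⊙ p) μ = r * eval p μ
  eval (X· p)  μ = eval p μ * μ

  act : ∀ {I : Set} → ((I → Carrier) → I → Carrier) → Polynomial → (I → Carrier) → I → Carrier
  act T one     f   = f
  act T (p ⊕ q) f i = act T p f i + act T q f i
  act T (r ⊙ p) f i = r * act T p f i
  act T (X· p)  f   = act T p (T f)

  act-cong : ∀ p {u v : Vector Carrier n} → (∀ x → u x ≈ v x) → ∀ x → act (A *ᵥ_) p u x ≈ act (A *ᵥ_) p v x
  act-cong one     u≈v x = u≈v x
  act-cong (p ⊕ q) u≈v x = +-cong (act-cong p u≈v x) (act-cong q u≈v x)
  act-cong (r ⊙ p) u≈v x = *-congˡ (act-cong p u≈v x)
  act-cong (X· p)  u≈v x = act-cong p (*ᵥ-cong u≈v) x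

  act-Φ : ∀ p ψ y x → act (A *ᵥ_) p (Φ ψ y) x ≈ Φ (act B p ψ) y x
  act-Φ one     ψ y x = refl
  act-Φ (p ⊕ q) ψ y x = +-cong (act-Φ p ψ y x) (act-Φ q ψ y x)
  act-Φ (r ⊙ p) ψ y x = *-congˡ (act-Φ p ψ y x)
  act-Φ (X· p)  ψ y x = trans (act-cong p (A*Φ ψ y) x) (act-Φ p (B ψ) y x)

  act-eigenvector : ∀ p {μ w} → Eigenspace A μ w → ∀ x → act (A *ᵥ_) p w x ≈ eval p μ * w x
  act-eigenvector one     Aw≈μw x = sym (*-identityˡ _)
  act-eigenvector (p ⊕ q) Aw≈μw x =
    trans (+-cong (act-eigenvector p Aw≈μw x) (act-eigenvector q Aw≈μw x)) (sym (distribʳ _ _ _))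
  act-eigenvector (r ⊙ p) Aw≈μw x = trans (*-congˡ (act-eigenvector p Aw≈μw x)) (sym (*-assoc _ _ _))
  act-eigenvector (X· p) {μ} {w} Aw≈μw x = begin
    act (A *ᵥ_) p (A *ᵥ w) x  ≈⟨ act-eigenvector p A²w≈μAw x ⟩
    eval p μ * (A *ᵥ w) x     ≈⟨ *-congˡ (Aw≈μw x) ⟩
    eval p μ * (μ * w x)      ≈⟨ *-assoc _ _ _ ⟨
    eval p μ * μ * w x        ∎
    where
    A²w≈μAw : Eigenspace A μ (A *ᵥ w)
    A²w≈μAw y = trans (*ᵥ-cong Aw≈μw y) (*ᵥ-scale μ w y)

  δ : ℕ → Sequence
  δ i j = ind (does (i ℕ.≟ j))

  δ-≡ : ∀ {i j} → i ≡ j → δ i j ≈ 1#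
  δ-≡ {i} {j} i≡j = reflexive (≡.cong ind (dec-true (i ℕ.≟ j) i≡j))

  δ-≢ : ∀ {i j} → i ≢ j → δ i j ≈ 0#
  δ-≢ {i} {j} i≢j = reflexive (≡.cong ind (dec-false (i ℕ.≟ j) i≢j))

  sum-δ₀ : ∀ y (f : Vector Carrier n) → sum (λ x → δ 0 (dist y x) * f x) ≈ f y
  sum-δ₀ y f = trans
    (sum-single {f = λ x → δ 0 (dist y x) * f x} y
      (λ x x≢y → trans (*-congʳ (δ-≢ (x≢y ∘ ≡.sym ∘ dist≡0 ∘ ≡.sym))) (zeroˡ _)))
    (trans (*-congʳ (δ-≡ (≡.sym (dist-refl y)))) (*-identityˡ _))

  c-suc≢0 : ∀ {i x y} → dist x y ≡ suc i → c (suc i) ≢ 0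
  c-suc≢0 {i} {x} {y} eq with z , y~z , eq′ ← closer-neighbour eq =
    Exactly⇒≢0 (c-count (≡⇒Dist eq)) (y~z , i , ≡.refl , ≡⇒Dist eq′)

  private
    Supported : ℕ → Sequence → Set _
    Supported i φ = ∀ x y → i ℕ.< dist x y → φ (dist x y) ≈ 0#

    Represents : Polynomial → Sequence → Set _
    Represents p φ = ∀ w y → ⟨ Φ φ y , w ⟩ ≈ act (A *ᵥ_) p w y

  -- Bδᵢ has leading coefficient cᵢ₊₁ in position i + 1, which is invertible if the distance i + 1 occurs.
  supported-polynomial : ∀ i φ → Supported i φ → ∃[ p ] Represents p φ
  supported-polynomial zero φ supported = φ 0 ⊙ one , λ w y →
    trans (sum-single {f = λ x → φ (dist y x) * w x} y
             (λ x x≢y → trans (*-congʳ (supported y x (ℕ.n≢0⇒n>0 (x≢y ∘ ≡.sym ∘ dist≡0)))) (zeroˡ _)))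
          (*-congʳ (reflexive (≡.cong φ (dist-refl y))))
  supported-polynomial (suc i) φ supported with c (suc i) ℕ.≟ 0
  -- In this case no pair is at distance `suc i`, so `φ` already has the smaller support.
  ... | yes c≡0 = supported-polynomial i φ λ x y i<d →
    supported x y (ℕ.≤∧≢⇒< i<d λ eq → c-suc≢0 (≡.sym eq) c≡0)
  ... | no c≢0 = p ⊕ r ⊙ X· q , represents
    where
    instance c-nonZero : NonZero (c (suc i))
             c-nonZero = ℕ.≢-nonZero c≢0
    inverse = #0⇒inverse (fromℕ#0 (c (suc i)))
    -- The multiple of `B (δ i)` that cancels the value of `φ` at `suc i`.
    r = φ (suc i) * proj₁ inverse
    δ-supported : Supported i (δ i)
    δ-supported x y i<d = δ-≢ (ℕ.<⇒≢ i<d)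
    φ′ : Sequence
    φ′ j = φ j - r * B (δ i) j
    φ′-supported : Supported i φ′
    φ′-supported x y i<d with ℕ.m≤n⇒m<n∨m≡n i<d
    -- `B` is tridiagonal, so `B (δ i)` has no entry beyond `suc i`.
    ... | inj₁ 1+i<d = begin
      φ d - r * B (δ i) d
        ≈⟨ +-cong (supported x y 1+i<d) (-‿cong (*-congˡ (+-cong (*-congˡ δ₀) (+-cong
             (*-congˡ (+-cong (δ-≢ i≢pred-d) (-‿cong δ₀)))
             (*-congˡ (+-cong (δ-≢ (ℕ.<⇒≢ (ℕ.m<n⇒m<1+n i<d))) (-‿cong δ₀))))))) ⟩
      0# - r * (k * 0# + (fromℕ (c d) * (0# - 0#) + fromℕ (b d) * (0# - 0#)))
        ≈⟨ solve 4 (λ r k c b → con (+ 0) :- r :* (k :* con (+ 0) :+ (c :* (con (+ 0) :- con (+ 0))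
             :+ b :* (con (+ 0) :- con (+ 0)))) := con (+ 0)) refl r k (fromℕ (c d)) (fromℕ (b d)) ⟩
      0# ∎
      where
      d = dist x y
      δ₀ = δ-≢ (ℕ.<⇒≢ i<d)
      i≢pred-d : i ≢ ℕ.pred d
      i≢pred-d eq = ℕ.<⇒≢ (ℕ.pred-mono-≤ 1+i<d) eq
    ... | inj₂ 1+i≡d = begin
      φ′ (dist x y)        ≡⟨ ≡.cong φ′ 1+i≡d ⟨
      φ′ (suc i)
        ≈⟨ +-congˡ (-‿cong (*-congˡ (+-cong (*-congˡ δ₀) (+-cong
             (*-congˡ (+-cong (δ-≡ {i} ≡.refl) (-‿cong δ₀)))
             (*-congˡ (+-cong (δ-≢ (ℕ.<⇒≢ (ℕ.m<n⇒m<1+n (ℕ.n<1+n i)))) (-‿cong δ₀))))))) ⟩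
      φ (suc i) - r * (k * 0# + (c₊ * (1# - 0#) + b₊ * (0# - 0#)))
        ≈⟨ solve 5 (λ f v k c b → f :- (f :* v) :* (k :* con (+ 0) :+ (c :* (con (+ 1) :- con (+ 0))
             :+ b :* (con (+ 0) :- con (+ 0)))) := f :* (con (+ 1) :- v :* c)) refl
             (φ (suc i)) (proj₁ inverse) k c₊ b₊ ⟩
      φ (suc i) * (1# - proj₁ inverse * c₊)
        ≈⟨ *-congˡ (≈⇒-≈0 (sym (proj₂ inverse))) ⟩
      φ (suc i) * 0#
        ≈⟨ zeroʳ _ ⟩
      0# ∎
      where
      c₊ = fromℕ (c (suc i))
      b₊ = fromℕ (b (suc i))
      δ₀ = δ-≢ (ℕ.<⇒≢ (ℕ.n<1+n i))
    IHφ′ = supported-polynomial i φ′ φ′-supported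
    p = proj₁ IHφ′
    IHδ = supported-polynomial i (δ i) δ-supported
    q = proj₁ IHδ
    represents : Represents (p ⊕ r ⊙ X· q) φ
    represents w y = begin
      sum (λ x → φ (dist y x) * w x)
        ≈⟨ sum-cong (λ x → solve 4 (λ f r g w → f :* w := (f :- r :* g) :* w :+ r :* (g :* w)) refl
             (φ (dist y x)) r (B (δ i) (dist y x)) (w x)) ⟩
      sum (λ x → Φ φ′ y x * w x + r * (Φ (B (δ i)) y x * w x))
        ≈⟨ ∑-distrib-+ (λ x → Φ φ′ y x * w x) _ ⟩
      ⟨ Φ φ′ y , w ⟩ + sum (λ x → r * (Φ (B (δ i)) y x * w x))
        ≈⟨ +-cong (proj₂ IHφ′ w y) (sym (*-distribˡ-sum r (λ x → Φ (B (δ i)) y x * w x))) ⟩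
      act (A *ᵥ_) p w y + r * ⟨ Φ (B (δ i)) y , w ⟩
        ≈⟨ +-congˡ (*-congˡ (⟨,⟩-cong (λ x → sym (A*Φ (δ i) y x)) (λ _ → refl))) ⟩
      act (A *ᵥ_) p w y + r * ⟨ A *ᵥ Φ (δ i) y , w ⟩
        ≈⟨ +-congˡ (*-congˡ (trans (A-self-adjoint (Φ (δ i) y) w) (proj₂ IHδ (A *ᵥ w) y))) ⟩
      act (A *ᵥ_) p w y + r * act (A *ᵥ_) q (A *ᵥ w) y ∎

  abstract
    -- No distance exceeds `D`, so every sequence counts as supported up to `D`.
    polynomial : ∀ φ → ∃[ p ] (∀ w y → ⟨ Φ φ y , w ⟩ ≈ act (A *ᵥ_) p w y)
    polynomial φ = supported-polynomial D φ
      λ x y D<d → contradiction (bounded (dist-Dist x y)) (ℕ.<⇒≱ D<d)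

  -- Closure of the algebra under products: as a polynomial in `A`, the first factor acts on the
  -- rows of `Φ ψ` through `B`, which keeps them functions of the distance.
  Φ-product : ∀ σ ψ → ∃[ h ] (∀ y x → ⟨ Φ σ x , Φ ψ y ⟩ ≈ Φ h y x)
  Φ-product σ ψ with p , represents ← polynomial σ =
    act B p ψ , λ y x → trans (represents (Φ ψ y) x) (act-Φ p ψ y x)

  -- The scalar is the polynomial of `Φ φ` evaluated at `μ`, hence the same for all eigenvectors `w`
  -- and all vertices `y`.
  ⟨Φ,eigenvector⟩ : ∀ φ μ → ∃[ κ ] (∀ {w} → Eigenspace A μ w → ∀ y → ⟨ Φ φ y , w ⟩ ≈ κ * w y)
  ⟨Φ,eigenvector⟩ φ μ with p , represents ← polynomial φ =
    eval p μ , λ {w} w∈V y → trans (represents w y) (act-eigenvector p w∈V y)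

  ⟨v,v⟩≈0⇒v≈0 : ∀ {v : Vector Carrier n} → ⟨ v , v ⟩ ≈ 0# → ∀ x → v x ≈ 0#
  ⟨v,v⟩≈0⇒v≈0 {v} vv≈0 x = square≈0⇒≈0 (sum≈0⇒≈0 (λ x → square≥0 (v x)) vv≈0 x)

  -- The squared norm of Φψ y does not depend on y.
  Φ-vanishes : ∀ ψ {y₀} → ⟨ Φ ψ y₀ , Φ ψ y₀ ⟩ ≈ 0# → ∀ y x → Φ ψ y x ≈ 0#
  Φ-vanishes ψ {y₀} norm≈0 y = ⟨v,v⟩≈0⇒v≈0 (begin
    ⟨ Φ ψ y , Φ ψ y ⟩    ≈⟨ proj₂ product y y ⟩
    h (dist y y)         ≡⟨ ≡.cong h (≡.trans (dist-refl y) (≡.sym (dist-refl y₀))) ⟩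
    h (dist y₀ y₀)       ≈⟨ proj₂ product y₀ y₀ ⟨
    ⟨ Φ ψ y₀ , Φ ψ y₀ ⟩  ≈⟨ norm≈0 ⟩
    0#                   ∎)
    where
    product = Φ-product ψ ψ
    h = proj₁ product

  ⟨,⟩-combine : ∀ (u v w : Vector Carrier n) r s →
                ⟨ (λ x → r * u x - s * v x) , w ⟩ ≈ r * ⟨ u , w ⟩ - s * ⟨ v , w ⟩
  ⟨,⟩-combine u v w r s = begin
    sum (λ x → (r * u x - s * v x) * w x)
      ≈⟨ sum-cong (λ x → solve 5 (λ r u s v w → (r :* u :- s :* v) :* w := r :* (u :* w) :- s :* (v :* w))
           refl r (u x) s (v x) (w x)) ⟩
    sum (λ x → r * (u x * w x) - s * (v x * w x))
      ≈⟨ sum-- (λ x → r * (u x * w x)) (λ x → s * (v x * w x)) ⟩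
    sum (λ x → r * (u x * w x)) - sum (λ x → s * (v x * w x))
      ≈⟨ +-cong (*-distribˡ-sum r (λ x → u x * w x)) (-‿cong (*-distribˡ-sum s (λ x → v x * w x))) ⟨
    r * ⟨ u , w ⟩ - s * ⟨ v , w ⟩ ∎

  ⟨,⟩-sym : ∀ (u v : Vector Carrier n) → ⟨ u , v ⟩ ≈ ⟨ v , u ⟩
  ⟨,⟩-sym u v = sum-cong λ x → *-comm (u x) (v x)

  *ᵥ-combine : ∀ (u v : Vector Carrier n) r s x →
               (A *ᵥ (λ y → r * u y - s * v y)) x ≈ r * (A *ᵥ u) x - s * (A *ᵥ v) x
  *ᵥ-combine u v r s x = begin
    ⟨ A x , (λ y → r * u y - s * v y) ⟩  ≈⟨ ⟨,⟩-sym (A x) _ ⟩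
    ⟨ (λ y → r * u y - s * v y) , A x ⟩  ≈⟨ ⟨,⟩-combine u v (A x) r s ⟩
    r * ⟨ u , A x ⟩ - s * ⟨ v , A x ⟩    ≈⟨ +-cong (*-congˡ (⟨,⟩-sym u (A x))) (-‿cong (*-congˡ (⟨,⟩-sym v (A x)))) ⟩
    r * (A *ᵥ u) x - s * (A *ᵥ v) x      ∎

  Eigenspace-combine : ∀ {μ u v} → Eigenspace A μ u → Eigenspace A μ v → ∀ r s →
                       Eigenspace A μ (λ x → r * u x - s * v x)
  Eigenspace-combine {μ} {u} {v} u∈V v∈V r s x = begin
    (A *ᵥ (λ y → r * u y - s * v y)) x  ≈⟨ *ᵥ-combine u v r s x ⟩
    r * (A *ᵥ u) x - s * (A *ᵥ v) x     ≈⟨ +-cong (*-congˡ (u∈V x)) (-‿cong (*-congˡ (v∈V x))) ⟩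
    r * (μ * u x) - s * (μ * v x)       ≈⟨ solve 5 (λ r m u s v → r :* (m :* u) :- s :* (m :* v) := m :* (r :* u :- s :* v))
                                             refl r μ (u x) s (v x) ⟩
    μ * (r * u x - s * v x)             ∎

  -- Cosine sequences and their idempotents.

  record IsCosines (μ : Carrier) (ω : Sequence) : Set ℓ₁ where
    field
      ω₀≈1       : ω 0 ≈ 1#
      eigenspace : ∀ y → Eigenspace A μ (Φ ω y)

    -- A pair at distance `i` is required because `ω` is constrained only at distances that occur.
    recurrence : ∀ {x y i} → dist y x ≡ i → B ω i ≈ μ * ω i
    recurrence {x} {y} ≡.refl = trans (sym (A*Φ ω y x)) (eigenspace y x)

    at-self : ∀ y → Φ ω y y ≈ 1#
    at-self y = trans (reflexive (≡.cong ω (dist-refl y))) ω₀≈1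

  recurrence⇒eigenspace : ∀ {μ} ω → (∀ y x → Φ (B ω) y x ≈ μ * Φ ω y x) → ∀ y → Eigenspace A μ (Φ ω y)
  recurrence⇒eigenspace ω rec y x = trans (A*Φ ω y x) (rec y x)

  -- The cosines of μ are the normalised averages of an eigenvector over the spheres around a vertex
  -- where it does not vanish; the residual of the recurrence is orthogonal to all Φψ y₀, hence to itself.
  eigenvalue⇒cosines : ∀ {μ} → IsEigenvalue A μ → ∃[ ω ] IsCosines μ ω
  eigenvalue⇒cosines {μ} (w , w∈V , y₀ , w₀#0) = ω , record
    { ω₀≈1       = ω₀≈1
    ; eigenspace = recurrence⇒eigenspace ω λ y x → -≈0⇒≈ (Φ-vanishes ρ norm≈0 y x)
    }
    where
    d : Fin n → ℕ
    d = dist y₀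

    size weight : Sequence
    size i   = sum (λ x → δ i (d x))
    weight i = sum (λ x → δ i (d x) * w x)

    δ≥0 : ∀ i j → δ i j ≥0
    δ≥0 i j with i ℕ.≟ j
    ... | yes i≡j = ≥0-resp-≈ (sym (δ-≡ i≡j)) (>0⇒≥0 0<1)
    ... | no  i≢j = ≥0-resp-≈ (sym (δ-≢ i≢j)) (<.irrefl refl)

    -- An empty sphere gets the default `0#`; the inverse law is only claimed for distances that
    -- occur from `y₀`.
    size-inverse : ∀ i → ∃[ v ] ((∃[ x ] d x ≡ i) → v * size i ≈ 1#)
    size-inverse i with Fin.any? (λ x → d x ℕ.≟ i)
    ... | no  none = 0# , λ some → contradiction some none
    ... | yes (x , eq) with v , inverse ← #0⇒inverse (>0⇒#0 (sum>0 (λ x → δ≥0 i (d x)) x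
            (<-resp refl (sym (δ-≡ (≡.sym eq))) 0<1))) = v , λ _ → inverse

    v : Sequence
    v i = proj₁ (size-inverse i)

    w₀⁻¹ : Carrier
    w₀⁻¹ = proj₁ (#0⇒inverse w₀#0)

    ω : Sequence
    ω i = weight i * v i * w₀⁻¹

    weight₀ : weight 0 ≈ w y₀
    weight₀ = sum-δ₀ y₀ w

    size₀ : size 0 ≈ 1#
    size₀ = trans (sum-cong (λ x → sym (*-identityʳ (δ 0 (d x))))) (sum-δ₀ y₀ (λ _ → 1#))

    ω₀≈1 : ω 0 ≈ 1#
    ω₀≈1 = begin
      weight 0 * v 0 * w₀⁻¹   ≈⟨ *-congʳ (*-cong weight₀ (trans (sym (*-identityʳ _)) (*-congˡ (sym size₀)))) ⟩
      w y₀ * (v 0 * size 0) * w₀⁻¹ ≈⟨ *-congʳ (*-congˡ (proj₂ (size-inverse 0) (y₀ , dist-refl y₀))) ⟩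
      w y₀ * 1# * w₀⁻¹        ≈⟨ solve 2 (λ w v → w :* con (+ 1) :* v := v :* w) refl (w y₀) w₀⁻¹ ⟩
      w₀⁻¹ * w y₀             ≈⟨ proj₂ (#0⇒inverse w₀#0) ⟩
      1#                      ∎

    δ-exchange : ∀ (f : Sequence) i j → δ i j * f i ≈ δ j i * f j
    δ-exchange f i j with i ℕ.≟ j
    ... | yes ≡.refl = refl
    ... | no  i≢j    = trans (trans (*-congʳ (δ-≢ i≢j)) (zeroˡ _))
                         (sym (trans (*-congʳ (δ-≢ (i≢j ∘ ≡.sym))) (zeroˡ _)))

    -- `Φ ψ y₀` is constant on the spheres around `y₀`, so pairing with it cannot tell `w` from its
    -- sphere averages.
    averaging : ∀ ψ → ⟨ Φ ψ y₀ , Φ ω y₀ ⟩ ≈ w₀⁻¹ * ⟨ Φ ψ y₀ , w ⟩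
    averaging ψ = begin
      sum (λ x → ψ (d x) * (weight (d x) * v (d x) * w₀⁻¹))
        ≈⟨ sum-cong (λ x → solve 4 (λ p W v i → p :* (W :* v :* i) := W :* (i :* (p :* v))) refl
             (ψ (d x)) (weight (d x)) (v (d x)) w₀⁻¹) ⟩
      sum (λ x → weight (d x) * f (d x))
        ≈⟨ sum-cong (λ x → *-distribʳ-sum (f (d x)) (λ z → δ (d x) (d z) * w z)) ⟩
      sum (λ x → sum (λ z → δ (d x) (d z) * w z * f (d x)))
        ≈⟨ ∑-comm (λ x z → δ (d x) (d z) * w z * f (d x)) ⟩
      sum (λ z → sum (λ x → δ (d x) (d z) * w z * f (d x)))
        ≈⟨ sum-cong (λ z → sum-cong (λ x → begin
             δ (d x) (d z) * w z * f (d x)    ≈⟨ solve 3 (λ e w f → e :* w :* f := (e :* f) :* w) refl (δ (d x) (d z)) (w z) (f (d x)) ⟩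
             δ (d x) (d z) * f (d x) * w z    ≈⟨ *-congʳ (δ-exchange f (d x) (d z)) ⟩
             δ (d z) (d x) * f (d z) * w z    ≈⟨ *-assoc _ _ _ ⟩
             δ (d z) (d x) * (f (d z) * w z)  ∎)) ⟩
      sum (λ z → sum (λ x → δ (d z) (d x) * (f (d z) * w z)))
        ≈⟨ sum-cong (λ z → *-distribʳ-sum (f (d z) * w z) (λ x → δ (d z) (d x))) ⟨
      sum (λ z → size (d z) * (f (d z) * w z))
        ≈⟨ sum-cong (λ z → begin
             size (d z) * (f (d z) * w z)
               ≈⟨ solve 5 (λ s i p v w → s :* (i :* (p :* v) :* w) := (v :* s) :* (i :* (p :* w)))
                    refl (size (d z)) w₀⁻¹ (ψ (d z)) (v (d z)) (w z) ⟩
             (v (d z) * size (d z)) * (w₀⁻¹ * (ψ (d z) * w z))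
               ≈⟨ *-congʳ (proj₂ (size-inverse (d z)) (z , ≡.refl)) ⟩
             1# * (w₀⁻¹ * (ψ (d z) * w z))
               ≈⟨ *-identityˡ _ ⟩
             w₀⁻¹ * (ψ (d z) * w z) ∎) ⟩
      sum (λ z → w₀⁻¹ * (ψ (d z) * w z))
        ≈⟨ *-distribˡ-sum w₀⁻¹ (λ z → ψ (d z) * w z) ⟨
      w₀⁻¹ * ⟨ Φ ψ y₀ , w ⟩ ∎
      where
      f : Sequence
      f i = w₀⁻¹ * (ψ i * v i)

    ρ : Sequence
    ρ i = B ω i - μ * ω i

    commuted : ∀ u → ⟨ Φ (B ρ) y₀ , u ⟩ ≈ ⟨ Φ ρ y₀ , A *ᵥ u ⟩
    commuted u = trans (⟨,⟩-cong (λ x → sym (A*Φ ρ y₀ x)) (λ _ → refl)) (A-self-adjoint (Φ ρ y₀) u)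

    -- Self-adjointness moves `A` onto `Φ ρ y₀`, after which `averaging` replaces `Φ ω y₀` by `w`;
    -- moved back, `A - μ` meets an eigenvector.
    norm≈0 : ⟨ Φ ρ y₀ , Φ ρ y₀ ⟩ ≈ 0#
    norm≈0 = begin
      ⟨ Φ ρ y₀ , Φ ρ y₀ ⟩
        ≈⟨ ⟨,⟩-cong (λ x → +-congʳ (trans (sym (A*Φ ω y₀ x)) (sym (*-identityˡ _)))) (λ _ → refl) ⟩
      ⟨ (λ x → 1# * (A *ᵥ Φ ω y₀) x - μ * Φ ω y₀ x) , Φ ρ y₀ ⟩
        ≈⟨ ⟨,⟩-combine (A *ᵥ Φ ω y₀) (Φ ω y₀) (Φ ρ y₀) 1# μ ⟩
      1# * ⟨ A *ᵥ Φ ω y₀ , Φ ρ y₀ ⟩ - μ * ⟨ Φ ω y₀ , Φ ρ y₀ ⟩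
        ≈⟨ +-cong (trans (*-identityˡ _) (trans (⟨,⟩-sym _ (Φ ρ y₀)) (sym (commuted (Φ ω y₀)))))
                  (-‿cong (*-congˡ (⟨,⟩-sym _ (Φ ρ y₀)))) ⟩
      ⟨ Φ (B ρ) y₀ , Φ ω y₀ ⟩ - μ * ⟨ Φ ρ y₀ , Φ ω y₀ ⟩
        ≈⟨ +-cong (averaging (B ρ)) (-‿cong (*-congˡ (averaging ρ))) ⟩
      w₀⁻¹ * ⟨ Φ (B ρ) y₀ , w ⟩ - μ * (w₀⁻¹ * ⟨ Φ ρ y₀ , w ⟩)
        ≈⟨ +-congʳ (*-congˡ (trans (commuted w) (⟨,⟩-cong (λ _ → refl) w∈V))) ⟩
      w₀⁻¹ * ⟨ Φ ρ y₀ , (λ x → μ * w x) ⟩ - μ * (w₀⁻¹ * ⟨ Φ ρ y₀ , w ⟩)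
        ≈⟨ +-congʳ (*-congˡ (trans
             (sum-cong (λ x → solve 3 (λ r m w → r :* (m :* w) := m :* (r :* w)) refl (Φ ρ y₀ x) μ (w x)))
             (sym (*-distribˡ-sum μ (λ x → Φ ρ y₀ x * w x))))) ⟩
      w₀⁻¹ * (μ * ⟨ Φ ρ y₀ , w ⟩) - μ * (w₀⁻¹ * ⟨ Φ ρ y₀ , w ⟩)
        ≈⟨ solve 3 (λ i m r → i :* (m :* r) :- m :* (i :* r) := con (+ 0)) refl w₀⁻¹ μ ⟨ Φ ρ y₀ , w ⟩ ⟩
      0# ∎


  module Cosines {μ ω} (isCosines : IsCosines μ ω) where
    open IsCosines isCosines public

    -- The factor between `Φ ω` and the projection onto the `μ`-eigenspace, that is, the number of
    -- vertices over the multiplicity of `μ`.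
    κ : Carrier
    κ = proj₁ (⟨Φ,eigenvector⟩ ω μ)

    reproducing : ∀ {w} → Eigenspace A μ w → ∀ y → ⟨ Φ ω y , w ⟩ ≈ κ * w y
    reproducing = proj₂ (⟨Φ,eigenvector⟩ ω μ)

    norm≈κ : ∀ y → ⟨ Φ ω y , Φ ω y ⟩ ≈ κ
    norm≈κ y = trans (reproducing (eigenspace y) y) (trans (*-congˡ (at-self y)) (*-identityʳ κ))

    κ>0 : Fin n → 0# < κ
    κ>0 y = <-resp refl (norm≈κ y) (sum>0 (λ x → square≥0 (Φ ω y x)) y
      (#0⇒square>0 (#-resp (sym (at-self y)) refl (>0⇒#0 0<1))))

    gram : ∀ x y → ⟨ Φ ω x , Φ ω y ⟩ ≈ κ * Φ ω x y
    gram x y = trans (reproducing (eigenspace y) x) (*-congˡ (reflexive (≡.cong ω (dist-sym y x))))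

    -- Let `e` be the unit vector at `y`. Both `κ` times its projection and `Φ ω y` lie in the
    -- eigenspace, and pairing either with an element of the eigenspace gives `κ` times the value at
    -- `y`. Their difference is thus orthogonal to itself.
    projection : ∀ {E} → IsOrthogonalProjection E (Eigenspace A μ) → ∀ x y → κ * E x y ≈ ω (dist x y)
    projection {E} isProjection x y = begin
      κ * E x y             ≈⟨ *-congˡ (column x) ⟨
      κ * p x               ≈⟨ solve 2 (λ a b → a := (a :- con (+ 1) :* b) :+ b) refl (κ * p x) (Φ ω y x) ⟩
      u x + Φ ω y x         ≈⟨ +-congʳ (⟨v,v⟩≈0⇒v≈0 norm≈0 x) ⟩
      0# + Φ ω y x          ≈⟨ +-identityˡ _ ⟩
      ω (dist y x)          ≡⟨ ≡.cong ω (dist-sym y x) ⟩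
      ω (dist x y)          ∎
      where
      e p u : Vector Carrier n
      e z = δ 0 (dist y z)
      p   = E *ᵥ e
      u z = κ * p z - 1# * Φ ω y z

      column : ∀ x → p x ≈ E x y
      column x = trans (⟨,⟩-sym (E x) e) (sum-δ₀ y (E x))

      p∈V : Eigenspace A μ p
      p∈V = proj₁ (isProjection e)

      u∈V : Eigenspace A μ u
      u∈V = Eigenspace-combine p∈V (eigenspace y) κ 1#

      ⟨p,u⟩ : ⟨ p , u ⟩ ≈ u y
      ⟨p,u⟩ = begin
        ⟨ p , u ⟩
          ≈⟨ solve 2 (λ a b → a := b :- (con (+ 1) :* b :- con (+ 1) :* a)) refl ⟨ p , u ⟩ ⟨ e , u ⟩ ⟩
        ⟨ e , u ⟩ - (1# * ⟨ e , u ⟩ - 1# * ⟨ p , u ⟩)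
          ≈⟨ +-congˡ (-‿cong (sym (⟨,⟩-combine e p u 1# 1#))) ⟩
        ⟨ e , u ⟩ - ⟨ (λ x → 1# * e x - 1# * p x) , u ⟩
          ≈⟨ +-congˡ (-‿cong (trans
               (⟨,⟩-cong (λ x → +-cong (*-identityˡ _) (-‿cong (*-identityˡ _))) (λ _ → refl))
               (proj₂ (isProjection e) u u∈V))) ⟩
        ⟨ e , u ⟩ - 0#
          ≈⟨ +-congʳ (sum-δ₀ y u) ⟩
        u y - 0#
          ≈⟨ solve 1 (λ a → a :- con (+ 0) := a) refl (u y) ⟩
        u y ∎

      norm≈0 : ⟨ u , u ⟩ ≈ 0#
      norm≈0 = begin
        ⟨ u , u ⟩                                  ≈⟨ ⟨,⟩-combine p (Φ ω y) u κ 1# ⟩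
        κ * ⟨ p , u ⟩ - 1# * ⟨ Φ ω y , u ⟩         ≈⟨ +-cong (*-congˡ ⟨p,u⟩) (-‿cong (*-congˡ (reproducing u∈V y))) ⟩
        κ * u y - 1# * (κ * u y)                   ≈⟨ solve 1 (λ a → a :- con (+ 1) :* a := con (+ 0)) refl (κ * u y) ⟩
        0#                                         ∎

  -- The largest eigenvalue.

  -- The Laplacian form of `k - A` as a sum of squares, with every edge met in both directions. Its
  -- sign bounds the eigenvalues by `k`, and its null vectors are constant along edges.
  A-edge-sum : ∀ w → sum (λ x → sum (λ y → A x y * ((w x - w y) * (w x - w y)))) ≈
                     (1# + 1#) * (k * ⟨ w , w ⟩ - ⟨ w , A *ᵥ w ⟩)
  A-edge-sum w = begin
    sum (λ x → sum (λ y → A x y * ((w x - w y) * (w x - w y))))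
      ≈⟨ sum-cong (λ x → sum-cong (λ y → solve 3 (λ a p q →
           a :* ((p :- q) :* (p :- q)) := (a :* (p :* p) :- p :* (a :* q)) :+ (a :* (q :* q) :- p :* (a :* q)))
           refl (A x y) (w x) (w y))) ⟩
    sum (λ x → sum (λ y → f x y + g x y))
      ≈⟨ sum-cong (λ x → ∑-distrib-+ (f x) (g x)) ⟩
    sum (λ x → sum (f x) + sum (g x))
      ≈⟨ ∑-distrib-+ (λ x → sum (f x)) (λ x → sum (g x)) ⟩
    sum (λ x → sum (f x)) + sum (λ x → sum (g x))
      ≈⟨ +-cong (split (λ x y → A x y * (w x * w x))) (split (λ x y → A x y * (w y * w y))) ⟩
    (sum (λ x → sum (λ y → A x y * (w x * w x))) - ⟨ w , A *ᵥ w ⟩) +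
    (sum (λ x → sum (λ y → A x y * (w y * w y))) - ⟨ w , A *ᵥ w ⟩)
      ≈⟨ +-cong (+-congʳ rows) (+-congʳ (trans (∑-comm (λ x y → A x y * (w y * w y)))
           (trans (sum-cong (λ y → sum-cong (λ x → *-congʳ (A-sym x y)))) rows))) ⟩
    (k * ⟨ w , w ⟩ - ⟨ w , A *ᵥ w ⟩) + (k * ⟨ w , w ⟩ - ⟨ w , A *ᵥ w ⟩)
      ≈⟨ solve 1 (λ a → a :+ a := (con (+ 1) :+ con (+ 1)) :* a) refl (k * ⟨ w , w ⟩ - ⟨ w , A *ᵥ w ⟩) ⟩
    (1# + 1#) * (k * ⟨ w , w ⟩ - ⟨ w , A *ᵥ w ⟩) ∎
    where
    f g : Matrix n
    f x y = A x y * (w x * w x) - w x * (A x y * w y)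
    g x y = A x y * (w y * w y) - w x * (A x y * w y)

    split : ∀ (h : Matrix n) → sum (λ x → sum (λ y → h x y - w x * (A x y * w y))) ≈
                      sum (λ x → sum (h x)) - ⟨ w , A *ᵥ w ⟩
    split h = begin
      sum (λ x → sum (λ y → h x y - w x * (A x y * w y)))
        ≈⟨ sum-cong (λ x → trans (sum-- (h x) (λ y → w x * (A x y * w y)))
             (+-congˡ (-‿cong (sym (*-distribˡ-sum (w x) (λ y → A x y * w y)))))) ⟩
      sum (λ x → sum (h x) - w x * (A *ᵥ w) x)
        ≈⟨ sum-- (λ x → sum (h x)) (λ x → w x * (A *ᵥ w) x) ⟩
      sum (λ x → sum (h x)) - ⟨ w , A *ᵥ w ⟩ ∎

    rows : sum (λ x → sum (λ y → A x y * (w x * w x))) ≈ k * ⟨ w , w ⟩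
    rows = begin
      sum (λ x → sum (λ y → A x y * (w x * w x)))
        ≈⟨ sum-cong (λ x → trans (sym (*-distribʳ-sum (w x * w x) (A x))) (*-congʳ (sum-A x))) ⟩
      sum (λ x → k * (w x * w x))
        ≈⟨ *-distribˡ-sum k (λ x → w x * w x) ⟨
      k * ⟨ w , w ⟩ ∎

  A-edge-sum-eigenvector : ∀ {μ w} → Eigenspace A μ w →
    sum (λ x → sum (λ y → A x y * ((w x - w y) * (w x - w y)))) ≈ (k - μ) * ((1# + 1#) * ⟨ w , w ⟩)
  A-edge-sum-eigenvector {μ} {w} w∈V = begin
    sum (λ x → sum (λ y → A x y * ((w x - w y) * (w x - w y))))
      ≈⟨ A-edge-sum w ⟩
    (1# + 1#) * (k * ⟨ w , w ⟩ - ⟨ w , A *ᵥ w ⟩)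
      ≈⟨ *-congˡ (+-congˡ (-‿cong (trans
           (sum-cong (λ x → trans (*-congˡ (w∈V x)) (solve 2 (λ m w → w :* (m :* w) := m :* (w :* w)) refl μ (w x))))
           (sym (*-distribˡ-sum μ (λ x → w x * w x)))))) ⟩
    (1# + 1#) * (k * ⟨ w , w ⟩ - μ * ⟨ w , w ⟩)
      ≈⟨ solve 3 (λ k m w → (con (+ 1) :+ con (+ 1)) :* (k :* w :- m :* w) := (k :- m) :* ((con (+ 1) :+ con (+ 1)) :* w))
           refl k μ ⟨ w , w ⟩ ⟩
    (k - μ) * ((1# + 1#) * ⟨ w , w ⟩) ∎

  A-edge≥0 : ∀ (w : Vector Carrier n) x y → A x y * ((w x - w y) * (w x - w y)) ≥0
  A-edge≥0 w x y with x ~? y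
  ... | yes _ = ≥0-resp-≈ (sym (*-identityˡ _)) (square≥0 (w x - w y))
  ... | no  _ = ≥0-resp-≈ (sym (zeroˡ _)) (<.irrefl refl)

  eigenvalue≤k : ∀ {μ} → IsEigenvalue A μ → ¬ (k < μ)
  eigenvalue≤k {μ} (w , w∈V , y , wy#0) k<μ =
    sum≥0 (λ x → sum≥0 (A-edge≥0 w x))
      (<-resp (trans (*-comm _ _) (sym (A-edge-sum-eigenvector w∈V))) refl (*-pos-neg norm>0 k-μ<0))
    where
    norm>0 : 0# < (1# + 1#) * ⟨ w , w ⟩
    norm>0 = *-pos (>0-+-≥0 0<1 (>0⇒≥0 0<1)) (sum>0 (λ x → square≥0 (w x)) y (#0⇒square>0 wy#0))
    k-μ<0 : k - μ < 0#
    k-μ<0 = <-resp refl (-‿inverseʳ μ) (+-monoˡ-< (- μ) k<μ)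

  k-eigenvector-constant : ∀ {w} → Eigenspace A k w → ∀ x y → w x ≈ w y
  k-eigenvector-constant {w} w∈V x y = along (proj₂ (connected x y))
    where
    edge : ∀ {x y} → x ~ y → w x ≈ w y
    edge {x} {y} x~y = -≈0⇒≈ (square≈0⇒≈0 (trans (sym (*-identityˡ _)) (trans (*-congʳ (sym (A-~ x~y)))
      (sum≈0⇒≈0 (A-edge≥0 w x) (sum≈0⇒≈0 (λ x → sum≥0 (A-edge≥0 w x))
        (trans (A-edge-sum-eigenvector w∈V) (trans (*-congʳ (-‿inverseʳ k)) (zeroˡ _))) x) y))))

    along : ∀ {x y l} → Walk Γ x y l → w x ≈ w y
    along stop         = refl
    along (step x~z W) = trans (edge x~z) (along W)

  k-cosines : IsCosines k (λ _ → 1#)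
  k-cosines = record
    { ω₀≈1       = refl
    ; eigenspace = recurrence⇒eigenspace (λ _ → 1#) λ y x →
        solve 3 (λ k c b → k :* con (+ 1) :+ (c :* (con (+ 1) :- con (+ 1)) :+ b :* (con (+ 1) :- con (+ 1)))
          := k :* con (+ 1)) refl k (fromℕ (c (dist y x))) (fromℕ (b (dist y x)))
    }

  cosines⇒eigenvalue : ∀ {μ ω} → Fin n → IsCosines μ ω → IsEigenvalue A μ
  cosines⇒eigenvalue {ω = ω} y isCosines =
    Φ ω y , IsCosines.eigenspace isCosines y , y , #-resp (sym (IsCosines.at-self isCosines y)) refl (>0⇒#0 0<1)

  IsCosines-resp-≈ : ∀ {μ ν ω} → μ ≈ ν → IsCosines μ ω → IsCosines ν ω
  IsCosines-resp-≈ μ≈ν isCosines = record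
    { ω₀≈1       = ω₀≈1
    ; eigenspace = λ y x → trans (eigenspace y x) (*-congʳ μ≈ν)
    }
    where open IsCosines isCosines

  -- Intersection numbers and sphere sizes.

  c₁≡1 : ∀ {x y} → x ~ y → c 1 ≡ 1
  c₁≡1 {x} {y} x~y with S , S⇔ , ∣S∣≡c₁ ← c-count (≡⇒Dist (~⇒dist≡1 x~y)) =
    ≡.trans (≡.sym ∣S∣≡c₁) (≡.trans (≡.cong ∣_∣ (⊆-antisym S⊆⁅x⁆ ⁅x⁆⊆S)) (∣⁅x⁆∣≡1 x))
    where
    S⊆⁅x⁆ : S ⊆ ⁅ x ⁆
    S⊆⁅x⁆ {z} z∈S with _ , zero , _ , stop , _ ← Equivalence.to (S⇔ z) z∈S = x∈⁅x⁆ x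
    ⁅x⁆⊆S : ⁅ x ⁆ ⊆ S
    ⁅x⁆⊆S {z} z∈⁅x⁆ with ≡.refl ← x∈⁅y⁆⇒x≡y x z∈⁅x⁆ =
      Equivalence.from (S⇔ z) (~-sym x~y , 0 , ≡.refl , ≡⇒Dist (dist-refl x))

  b₁≢0 : ∀ {x y} → dist x y ≡ 2 → b 1 ≢ 0
  b₁≢0 {x} {y} eq with z , y~z , eq′ ← closer-neighbour eq =
    Exactly⇒≢0 (b-count (≡⇒Dist eq′)) (~-sym y~z , ≡⇒Dist eq)

  size₂ : Fin n → Carrier
  size₂ y = sum (λ x → δ 2 (dist y x))

  sum-Φ-diameter-2 : (∀ x y → dist x y ℕ.≤ 2) →
                     ∀ y φ → sum (Φ φ y) ≈ φ 0 + (k * φ 1 + size₂ y * φ 2)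
  sum-Φ-diameter-2 dist≤2 y φ = begin
    sum (Φ φ y)
      ≈⟨ sum-cong (λ x → pointwise (dist y x) (dist≤2 y x)) ⟩
    sum (λ x → δ 0 (dist y x) * φ 0 + (δ 1 (dist y x) * φ 1 + δ 2 (dist y x) * φ 2))
      ≈⟨ trans (∑-distrib-+ (λ x → δ 0 (dist y x) * φ 0) _)
           (+-congˡ (∑-distrib-+ (λ x → δ 1 (dist y x) * φ 1) (λ x → δ 2 (dist y x) * φ 2))) ⟩
    sum (λ x → δ 0 (dist y x) * φ 0) + (sum (λ x → δ 1 (dist y x) * φ 1) + sum (λ x → δ 2 (dist y x) * φ 2))
      ≈⟨ +-cong (sum-δ₀ y (λ _ → φ 0)) (+-cong
           (trans (sym (*-distribʳ-sum (φ 1) (λ x → δ 1 (dist y x))))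
                  (*-congʳ (trans (sum-cong neighbour) (sum-A y))))
           (sym (*-distribʳ-sum (φ 2) (λ x → δ 2 (dist y x))))) ⟩
    φ 0 + (k * φ 1 + size₂ y * φ 2) ∎
    where
    pointwise : ∀ d → d ℕ.≤ 2 → φ d ≈ δ 0 d * φ 0 + (δ 1 d * φ 1 + δ 2 d * φ 2)
    pointwise 0 _ = solve 3 (λ a b c → a := con (+ 1) :* a :+ (con (+ 0) :* b :+ con (+ 0) :* c)) refl (φ 0) (φ 1) (φ 2)
    pointwise 1 _ = solve 3 (λ a b c → b := con (+ 0) :* a :+ (con (+ 1) :* b :+ con (+ 0) :* c)) refl (φ 0) (φ 1) (φ 2)
    pointwise 2 _ = solve 3 (λ a b c → c := con (+ 0) :* a :+ (con (+ 0) :* b :+ con (+ 1) :* c)) refl (φ 0) (φ 1) (φ 2)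
    pointwise (suc (suc (suc _))) (s≤s (s≤s ()))

    neighbour : ∀ x → δ 1 (dist y x) ≈ A y x
    neighbour x with y ~? x
    ... | yes y~x = δ-≡ (≡.sym (~⇒dist≡1 y~x))
    ... | no  y≁x = δ-≢ (y≁x ∘ dist≡1⇒~ ∘ ≡.sym)

  sum-Φ-B : ∀ φ y → sum (Φ (B φ) y) ≈ k * sum (Φ φ y)
  sum-Φ-B φ y = begin
    sum (Φ (B φ) y)                    ≈⟨ sum-cong (λ x → trans (sym (*-identityʳ _)) (*-congʳ (sym (A*Φ φ y x)))) ⟩
    ⟨ A *ᵥ Φ φ y , (λ _ → 1#) ⟩        ≈⟨ A-self-adjoint (Φ φ y) (λ _ → 1#) ⟩
    ⟨ Φ φ y , A *ᵥ (λ _ → 1#) ⟩        ≈⟨ ⟨,⟩-cong (λ _ → refl) (IsCosines.eigenspace k-cosines y) ⟩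
    ⟨ Φ φ y , (λ _ → k * 1#) ⟩         ≈⟨ sum-cong (λ x → solve 2 (λ f k → f :* (k :* con (+ 1)) := k :* f) refl (Φ φ y x) k) ⟩
    sum (λ x → k * Φ φ y x)            ≈⟨ *-distribˡ-sum k (Φ φ y) ⟨
    k * sum (Φ φ y)                    ∎

  -- The count of edges between the first and second spheres, read off from `sum-Φ-B` for the
  -- indicator of distance two.
  size₂-count : (∀ x y → dist x y ℕ.≤ 2) → ∀ y → fromℕ (c 2) * size₂ y ≈ k * fromℕ (b 1)
  size₂-count dist≤2 y = -≈0⇒≈ (begin
    c₂ * N - k * b₁
      ≈⟨ solve 7 (λ k N c₀ b₁ b₂ c₁ c₂ →
           let o = con (+ 0); i = con (+ 1)
               at-0 = k :* o :+ (c₀ :* (o :- o) :+ k :* (o :- o))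
               at-1 = k :* o :+ (c₁ :* (o :- o) :+ b₁ :* (i :- o))
               at-2 = k :* i :+ (c₂ :* (o :- i) :+ b₂ :* (i :- i))
           in c₂ :* N :- k :* b₁ :=
              k :* (o :+ (k :* o :+ N :* i)) :- (at-0 :+ (k :* at-1 :+ N :* at-2)))
           refl k N (fromℕ (c 0)) b₁ (fromℕ (b 2)) (fromℕ (c 1)) c₂ ⟩
    k * (φ 0 + (k * φ 1 + N * φ 2)) - (B φ 0 + (k * B φ 1 + N * B φ 2))
      ≈⟨ ≈⇒-≈0 (trans (*-congˡ (sym (sum-Φ-diameter-2 dist≤2 y φ)))
           (trans (sym (sum-Φ-B φ y)) (sum-Φ-diameter-2 dist≤2 y (B φ)))) ⟩
    0# ∎)
    where
    N = size₂ y
    b₁ = fromℕ (b 1)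
    c₂ = fromℕ (c 2)
    φ : Sequence
    φ 0 = 0#
    φ 1 = 0#
    -- The value at `3` is `1#` as well, so that the `b 2` term of `B φ 2` cancels.
    φ (suc (suc _)) = 1#

  -- Multiplication by `A - μ`, on the level of sequences.
  shift : Carrier → Sequence → Sequence
  shift μ φ i = B φ i - μ * φ i

  -- Associativity: `A` may be applied to the factor `Φ σ` or to the finished product.
  B-intertwines : ∀ σ h {w y} → (∀ x → ⟨ Φ σ x , w ⟩ ≈ Φ h y x) → ∀ x → ⟨ Φ (B σ) x , w ⟩ ≈ Φ (B h) y x
  B-intertwines σ h {w} {y} σ→h x = begin
    sum (λ z → B σ (dist x z) * w z)
      ≈⟨ sum-cong (λ z → *-congʳ (trans (reflexive (≡.cong (B σ) (dist-sym x z))) (sym (A*Φ σ z x)))) ⟩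
    sum (λ z → sum (λ t → A x t * σ (dist z t)) * w z)
      ≈⟨ sum-cong (λ z → *-distribʳ-sum (w z) (λ t → A x t * σ (dist z t))) ⟩
    sum (λ z → sum (λ t → A x t * σ (dist z t) * w z))
      ≈⟨ ∑-comm (λ z t → A x t * σ (dist z t) * w z) ⟩
    sum (λ t → sum (λ z → A x t * σ (dist z t) * w z))
      ≈⟨ sum-cong (λ t → trans
           (sum-cong (λ z → trans (*-assoc _ _ _) (*-congˡ (*-congʳ (reflexive (≡.cong σ (dist-sym z t)))))))
           (sym (*-distribˡ-sum (A x t) (λ z → σ (dist t z) * w z)))) ⟩
    sum (λ t → A x t * ⟨ Φ σ t , w ⟩)  ≈⟨ *ᵥ-cong σ→h x ⟩
    (A *ᵥ Φ h y) x                     ≈⟨ A*Φ h y x ⟩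
    Φ (B h) y x                        ∎

  shift-intertwines : ∀ μ σ h {w y} → (∀ x → ⟨ Φ σ x , w ⟩ ≈ Φ h y x) →
                      ∀ x → ⟨ Φ (shift μ σ) x , w ⟩ ≈ Φ (shift μ h) y x
  shift-intertwines μ σ h {w} {y} σ→h x = begin
    ⟨ Φ (shift μ σ) x , w ⟩
      ≈⟨ ⟨,⟩-cong (λ z → +-congʳ (sym (*-identityˡ (B σ (dist x z))))) (λ _ → refl) ⟩
    ⟨ (λ z → 1# * Φ (B σ) x z - μ * Φ σ x z) , w ⟩
      ≈⟨ ⟨,⟩-combine (Φ (B σ) x) (Φ σ x) w 1# μ ⟩
    1# * ⟨ Φ (B σ) x , w ⟩ - μ * ⟨ Φ σ x , w ⟩
      ≈⟨ +-cong (trans (*-identityˡ _) (B-intertwines σ h σ→h x)) (-‿cong (*-congˡ (σ→h x))) ⟩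
    Φ (shift μ h) y x ∎

  largest-eigenvalue : ∀ {θ} → Fin n → DistinctEigenvalues A D θ → θ 0 ≈ k
  largest-eigenvalue {θ} y distinct = from-index (exhaustive (cosines⇒eigenvalue y k-cosines))
    where
    open DistinctEigenvalues distinct
    from-index : ∃[ j ] (j ℕ.≤ D × k ≈ θ j) → θ 0 ≈ k
    from-index (zero  , _     , k≈θ₀) = sym k≈θ₀
    from-index (suc j , 1+j≤D , k≈θⱼ) = contradiction
      (<-resp (sym k≈θⱼ) refl (decreasing (s≤s z≤n) 1+j≤D)) (eigenvalue≤k (eigenvalues z≤n))

-- Schur products of positive semidefinite kernels.

module Kernels {ℓ ℓ₁ ℓ₂ : Level} (ℝ : RealNumbers ℓ ℓ₁ ℓ₂) {m : ℕ} where

  open RealProperties ℝ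

  Kernel : Set ℓ
  Kernel = Fin m → Fin m → Carrier

  quad : Kernel → Vector Carrier m → Carrier
  quad K v = sum (λ y → sum (λ z → v y * v z * K y z))

  PSD : Kernel → Set _
  PSD K = ∀ v → quad K v ≥0

  1ₖ : Kernel
  1ₖ _ _ = 1#

  infixl 7 _∘ₖ_
  _∘ₖ_ : Kernel → Kernel → Kernel
  (K ∘ₖ L) y z = K y z * L y z

  gramₖ : ∀ {n} → (Fin n → Vector Carrier m) → Kernel
  gramₖ g y z = sum (λ a → g a y * g a z)

  quad-1ₖ : ∀ v → quad 1ₖ v ≈ sum v * sum v
  quad-1ₖ v = begin
    quad 1ₖ v                               ≈⟨ sum-cong {m} (λ y → sum-cong {m} (λ z → *-identityʳ (v y * v z))) ⟩
    sum (λ y → sum (λ z → v y * v z))       ≈⟨ sum-cong (λ y → *-distribˡ-sum (v y) v) ⟨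
    sum (λ y → v y * sum v)                 ≈⟨ *-distribʳ-sum (sum v) v ⟨
    sum v * sum v                           ∎

  1ₖ-PSD : PSD 1ₖ
  1ₖ-PSD v = ≥0-resp-≈ (sym (quad-1ₖ v)) (square≥0 (sum v))

  -- The Schur product theorem as an identity. Being a sum of forms of `K`, the left side inherits
  -- positivity, and when it vanishes so does each summand.
  quad-∘-gram : ∀ {n} K (g : Fin n → Vector Carrier m) v →
                quad (K ∘ₖ gramₖ g) v ≈ sum (λ a → quad K (λ y → v y * g a y))
  quad-∘-gram K g v = begin
    sum (λ y → sum (λ z → v y * v z * (K y z * gramₖ g y z)))
      ≈⟨ sum-cong (λ y → sum-cong (λ z → expand y z)) ⟩
    sum (λ y → sum (λ z → sum (λ a → term a y z)))
      ≈⟨ sum-cong (λ y → ∑-comm (λ z a → term a y z)) ⟩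
    sum (λ y → sum (λ a → sum (λ z → term a y z)))
      ≈⟨ ∑-comm (λ y a → sum (λ z → term a y z)) ⟩
    sum (λ a → quad K (λ y → v y * g a y)) ∎
    where
    term : ∀ a y z → Carrier
    term a y z = v y * g a y * (v z * g a z) * K y z
    expand : ∀ y z → v y * v z * (K y z * gramₖ g y z) ≈ sum (λ a → term a y z)
    expand y z = begin
      v y * v z * (K y z * gramₖ g y z)               ≈⟨ *-assoc _ _ _ ⟨
      v y * v z * K y z * gramₖ g y z                 ≈⟨ *-distribˡ-sum _ (λ a → g a y * g a z) ⟩
      sum (λ a → v y * v z * K y z * (g a y * g a z))
        ≈⟨ sum-cong (λ a → solve 5 (λ v w k g h → v :* w :* k :* (g :* h) := v :* g :* (w :* h) :* k) refl
             (v y) (v z) (K y z) (g a y) (g a z)) ⟩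
      sum (λ a → term a y z)                          ∎

  ∘-gram-PSD : ∀ {n K} (g : Fin n → Vector Carrier m) → PSD K → PSD (K ∘ₖ gramₖ g)
  ∘-gram-PSD {K = K} g psd v = ≥0-resp-≈ (sym (quad-∘-gram K g v)) (sum≥0 {f = λ a → quad K (λ y → v y * g a y)} (λ a → psd _))

  ∘-gram-null : ∀ {n K} (g : Fin n → Vector Carrier m) → PSD K → ∀ {v} → quad (K ∘ₖ gramₖ g) v ≈ 0# →
                ∀ a → quad K (λ y → v y * g a y) ≈ 0#
  ∘-gram-null {K = K} g psd null = sum≈0⇒≈0 {f = λ a → quad K _} (λ a → psd _) (trans (sym (quad-∘-gram K g _)) null)

  -- The left side is the squared norm of the tensor ∑ᵧ g(y) ⊗ g(y) ⊗ g(y).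
  cubic-null : ∀ {n} (g : Fin n → Vector Carrier m) →
               sum (λ y → sum (λ z → gramₖ g y z * gramₖ g y z * gramₖ g y z)) ≈ 0# →
               ∀ a b c → sum (λ y → g a y * g b y * g c y) ≈ 0#
  cubic-null g null a b c = trans
    (sum-cong (λ y → *-congʳ (*-congʳ (sym (*-identityˡ (g a y))))))
    -- Each `∘-gram-null` strips one Gram factor and fixes one tensor index; what remains is the
    -- form of `1ₖ`, a perfect square.
    (square≈0⇒≈0 (trans (sym (quad-1ₖ _))
      (∘-gram-null g 1ₖ-PSD (∘-gram-null g (∘-gram-PSD g 1ₖ-PSD)
        (∘-gram-null g (∘-gram-PSD g (∘-gram-PSD g 1ₖ-PSD)) null′ a) b) c)))
    where
    null′ : quad (1ₖ ∘ₖ gramₖ g ∘ₖ gramₖ g ∘ₖ gramₖ g) (λ _ → 1#) ≈ 0#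
    null′ = trans (sum-cong (λ y → sum-cong (λ z →
      solve 1 (λ g → con (+ 1) :* con (+ 1) :* (con (+ 1) :* g :* g :* g) := g :* g :* g) refl (gramₖ g y z)))) null

  product-gram≥0 : ∀ {n n′} (g : Fin n → Vector Carrier m) (g′ : Fin n′ → Vector Carrier m) →
                   sum (λ y → sum (λ z → gramₖ g y z * gramₖ g′ y z)) ≥0
  product-gram≥0 g g′ = ≥0-resp-≈
    (sum-cong (λ y → sum-cong (λ z →
      solve 2 (λ g h → con (+ 1) :* con (+ 1) :* (con (+ 1) :* g :* h) := g :* h) refl (gramₖ g y z) (gramₖ g′ y z))))
    (∘-gram-PSD g′ (∘-gram-PSD g 1ₖ-PSD) (λ _ → 1#))

-- Induced subgraphs of diameter two are isometric.

module InducedDiameter2 {m n : ℕ} {Q : Graph m} {Γ : Graph n} (Q⊆Γ : Q InducedIn Γ)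
  (Q-connected : ∀ x y → ∃[ l ] Walk Q x y l) (Γ-connected : ∀ x y → ∃[ l ] Walk Γ x y l)
  (diameter≤2 : ∀ {x y d} → Dist Q x y d → d ℕ.≤ 2) where

  open _InducedIn_ Q⊆Γ
  private
    module Q = Distance Q Q-connected
    module Γ = Distance Γ Γ-connected

  embed-walk : ∀ {x y l} → Walk Q x y l → Walk Γ (embed x) (embed y) l
  embed-walk stop         = stop
  embed-walk (step x~y w) = step (Equivalence.to adjacency x~y) (embed-walk w)

  -- Equality and adjacency are the same in both graphs, and vertices at distance two in `Q` keep
  -- their path of length two; diameter two leaves no further case.
  isometric : ∀ x y → Γ.dist (embed x) (embed y) ≡ Q.dist x y
  isometric x y with Q.dist x y in eq | diameter≤2 (Q.dist-Dist x y)
  ... | 0 | _ = ≡.trans (≡.cong (λ z → Γ.dist (embed x) (embed z)) (≡.sym (Q.dist≡0 eq))) (Γ.dist-refl (embed x))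
  ... | 1 | _ = Γ.~⇒dist≡1 (Equivalence.to adjacency (Q.dist≡1⇒~ eq))
  ... | 2 | _ = ℕ.≤-antisym (Γ.dist≤ (embed-walk (proj₁ (Q.≡⇒Dist eq)))) (ℕ.≤∧≢⇒< (ℕ.n≢0⇒n>0 ≢0) (≢1 ∘ ≡.sym))
    where
    ≢0 : Γ.dist (embed x) (embed y) ≢ 0
    ≢0 eq′ = contradiction (≡.trans (≡.sym eq) (≡.trans (≡.cong (Q.dist x) (≡.sym (injective (Γ.dist≡0 eq′)))) (Q.dist-refl x))) λ ()
    ≢1 : Γ.dist (embed x) (embed y) ≢ 1
    ≢1 eq′ = contradiction (≡.trans (≡.sym eq) (Q.~⇒dist≡1 (Equivalence.from adjacency (Γ.dist≡1⇒~ eq′)))) λ ()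
  ... | suc (suc (suc _)) | s≤s (s≤s ())

-- The quadrangle inside `Γ`, and the origin of `η`.

module GQ-LightTail {ℓ ℓ₁ ℓ₂ : Level} (ℝ : RealNumbers ℓ ℓ₁ ℓ₂) {n D : ℕ} (Γ : Graph n) (b c : ℕ → ℕ)
  (Γ-regular : IsDistanceRegular Γ D b c) (a₁ : ℕ) (a₁≢0 : a₁ ≢ 0) (b₀≡1+a₁+b₁ : b 0 ≡ suc a₁ ℕ.+ b 1)
  {m : ℕ} (Q : Graph m) (bQ cQ : ℕ → ℕ) (Q-regular : IsDistanceRegular Q 2 bQ cQ) (Q⊆Γ : Q InducedIn Γ)
  (bQ₀≡ : bQ 0 ≡ (suc a₁ ℕ.^ 2 ℕ.+ 1) ℕ.* suc a₁) (bQ₁≡ : bQ 1 ≡ suc a₁ ℕ.^ 2 ℕ.* suc a₁)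
  (cQ₂≡ : cQ 2 ≡ suc a₁ ℕ.^ 2 ℕ.+ 1)
  where

  open RealProperties ℝ
  open Spectral ℝ using (Matrix; adjacencyMatrix; ⟨_,_⟩; Eigenspace; IsEigenvalue;
    IsOrthogonalProjection; DistinctEigenvalues; IsLightTail)
  open DistanceRegular ℝ Γ b c Γ-regular
  open IsDistanceRegular Γ-regular using (connected)
  open _InducedIn_ Q⊆Γ using (embed)
  open Kernels ℝ {m}
  private
    module Q  = DistanceRegular ℝ Q bQ cQ Q-regular
    module QI = IsDistanceRegular Q-regular
  open InducedDiameter2 Q⊆Γ QI.connected connected QI.bounded using (isometric)

  k a s b₁ c₁ η : Carrier
  k  = fromℕ (b 0)
  a  = fromℕ a₁
  s  = fromℕ (suc a₁)
  b₁ = fromℕ (b 1)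
  c₁ = fromℕ (c 1)
  η  = (k - fromℕ (suc a₁ ℕ.* (a₁ ℕ.+ 2))) ÷ (suc a₁ ℕ.^ 2)

  private
    -- These vertices witness that the distances zero, one and two occur in `Γ`, which gives access
    -- to the recurrences at zero and one and makes `b 1` nonzero.
    p₀ p₁ p₂ : Fin m
    p₀ = proj₁ QI.attained
    p₂ = proj₁ (proj₂ QI.attained)
    d₀₂ : Q.dist p₀ p₂ ≡ 2
    d₀₂ = Q.Dist⇒≡ (proj₂ (proj₂ QI.attained))
    p₁ = proj₁ (Q.closer-neighbour d₀₂)
    d₀₁ : Q.dist p₀ p₁ ≡ 1
    d₀₁ = proj₂ (proj₂ (Q.closer-neighbour d₀₂))

    y₀ y₁ y₂ : Fin n
    y₀ = embed p₀
    y₁ = embed p₁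
    y₂ = embed p₂
    e₁ : dist y₀ y₁ ≡ 1
    e₁ = ≡.trans (isometric p₀ p₁) d₀₁
    e₂ : dist y₀ y₂ ≡ 2
    e₂ = ≡.trans (isometric p₀ p₂) d₀₂

    s>0 : 0# < s
    s>0 = fromℕ-positive a₁

    s#0 : s # 0#
    s#0 = >0⇒#0 s>0

    a>0 : 0# < a
    a>0 = ≢0⇒fromℕ>0 a₁≢0

    k>0 : 0# < k
    k>0 = ≢0⇒fromℕ>0 λ k≡0 → contradiction (≡.trans (≡.sym b₀≡1+a₁+b₁) k≡0) λ ()

    b₁>0 : 0# < b₁
    b₁>0 = ≢0⇒fromℕ>0 (b₁≢0 e₂)

    -- Relations between the parameters are kept as differences that vanish: later identities write
    -- the difference of their two sides as an explicit combination of these, and the ring solver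
    -- checks it.
    k≈s+b₁ : k - (s + b₁) ≈ 0#
    k≈s+b₁ = ≈⇒-≈0 (trans (reflexive (≡.cong fromℕ b₀≡1+a₁+b₁)) (fromℕ-homo-+ (suc a₁) (b 1)))

    c₁≈1 : c₁ - 1# ≈ 0#
    c₁≈1 = ≈⇒-≈0 (trans (reflexive (≡.cong fromℕ (c₁≡1 (dist≡1⇒~ e₁)))) (+-identityʳ 1#))

    s² : fromℕ (suc a₁ ℕ.^ 2) ≈ s * s
    s² = trans (fromℕ-homo-* (suc a₁) (suc a₁ ℕ.* 1)) (*-congˡ (reflexive (≡.cong fromℕ (ℕ.*-identityʳ (suc a₁)))))

    s²+1 : fromℕ (suc a₁ ℕ.^ 2 ℕ.+ 1) ≈ s * s + 1#
    s²+1 = trans (fromℕ-homo-+ (suc a₁ ℕ.^ 2) 1) (+-cong s² (+-identityʳ 1#))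

  s²η≈ : s * s * η - (k - s * (s + 1#)) ≈ 0#
  s²η≈ = ≈⇒-≈0 (begin
    s * s * η                                ≈⟨ *-comm _ _ ⟩
    η * (s * s)                              ≈⟨ *-congˡ s² ⟨
    η * fromℕ (suc a₁ ℕ.^ 2)                 ≈⟨ ÷-correct _ (suc a₁ ℕ.^ 2) ⟩
    k - fromℕ (suc a₁ ℕ.* (a₁ ℕ.+ 2))        ≈⟨ +-congˡ (-‿cong (trans (fromℕ-homo-* (suc a₁) (a₁ ℕ.+ 2)) (*-congˡ (fromℕ-homo-+ a₁ 2)))) ⟩
    k - s * (a + fromℕ 2)
      ≈⟨ solve 3 (λ k s a → k :- s :* (a :+ (con (+ 1) :+ (con (+ 1) :+ con (+ 0)))) :=
           k :- s :* (con (+ 1) :+ a :+ con (+ 1))) refl k s a ⟩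
    k - s * (s + 1#)                         ∎)

  private
    kQ≈ : fromℕ (bQ 0) ≈ (s * s + 1#) * s
    kQ≈ = trans (reflexive (≡.cong fromℕ bQ₀≡)) (trans (fromℕ-homo-* (suc a₁ ℕ.^ 2 ℕ.+ 1) (suc a₁)) (*-congʳ s²+1))

    size₂≈ : ∀ q → Q.size₂ q ≈ s * s * (s * s)
    size₂≈ q = *-cancel-#0 (>0⇒#0 t+1>0) (begin
      (s * s + 1#) * Q.size₂ q          ≈⟨ *-congʳ (trans (sym s²+1) (reflexive (≡.cong fromℕ (≡.sym cQ₂≡)))) ⟩
      fromℕ (cQ 2) * Q.size₂ q          ≈⟨ Q.size₂-count (λ x y → QI.bounded (Q.dist-Dist x y)) q ⟩
      fromℕ (bQ 0) * fromℕ (bQ 1)       ≈⟨ *-cong kQ≈ (trans (reflexive (≡.cong fromℕ bQ₁≡))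
                                             (trans (fromℕ-homo-* (suc a₁ ℕ.^ 2) (suc a₁)) (*-congʳ s²))) ⟩
      (s * s + 1#) * s * (s * s * s)    ≈⟨ solve 1 (λ s → (s :* s :+ con (+ 1)) :* s :* (s :* s :* s) :=
                                             (s :* s :+ con (+ 1)) :* (s :* s :* (s :* s))) refl s ⟩
      (s * s + 1#) * (s * s * (s * s))  ∎)
      where
      t+1>0 : 0# < s * s + 1#
      t+1>0 = >0-+-≥0 (*-pos s>0 s>0) (>0⇒≥0 0<1)

  sum-over-Q : ∀ p φ → sum (λ q → φ (dist (embed p) (embed q))) ≈
                       φ 0 + ((s * s + 1#) * s * φ 1 + s * s * (s * s) * φ 2)
  sum-over-Q p φ = begin
    sum (λ q → φ (dist (embed p) (embed q)))
      ≈⟨ sum-cong (λ q → reflexive (≡.cong φ (isometric p q))) ⟩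
    sum (Q.Φ φ p)
      ≈⟨ Q.sum-Φ-diameter-2 (λ x y → QI.bounded (Q.dist-Dist x y)) p φ ⟩
    φ 0 + (fromℕ (bQ 0) * φ 1 + Q.size₂ p * φ 2)
      ≈⟨ +-congˡ (+-cong (*-congʳ kQ≈) (*-congʳ (size₂≈ p))) ⟩
    φ 0 + ((s * s + 1#) * s * φ 1 + s * s * (s * s) * φ 2) ∎

  -- The weights are proportional to the cosines of the smallest eigenvalue of GQ(s, s²) times its sphere sizes.
  L : Sequence → Carrier
  L φ = φ 0 - (1# + s * s) * φ 1 + s * s * φ 2

  quadratic : Sequence → Sequence
  quadratic φ = shift k (shift η φ)

  -- Both sides are functionals of `φ 0`, `φ 1`, `φ 2` that vanish on constants, so only the ratio
  -- of the outer weights has to match. That condition is `s² (1 + η) = b₁`, and it determines `η`.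
  quadratic₀ : ∀ φ → s * s * quadratic φ 0 ≈ k * b₁ * L φ
  quadratic₀ φ = -≈0⇒≈ (begin
    s * s * quadratic φ 0 - k * b₁ * L φ
      ≈⟨ solve 9 (λ k b₁ c₀ c₁ s η f₀ f₁ f₂ →
           let i = con (+ 1)
               χ₀ = k :* f₀ :+ (c₀ :* (f₀ :- f₀) :+ k :* (f₁ :- f₀)) :- η :* f₀
               χ₁ = k :* f₁ :+ (c₁ :* (f₀ :- f₁) :+ b₁ :* (f₂ :- f₁)) :- η :* f₁
           in s :* s :* (k :* χ₀ :+ (c₀ :* (χ₀ :- χ₀) :+ k :* (χ₁ :- χ₀)) :- k :* χ₀)
              :- k :* b₁ :* (f₀ :- (i :+ s :* s) :* f₁ :+ s :* s :* f₂) :=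
              k :* (f₀ :- f₁) :* (s :* s :* (c₁ :- i) :+
                (s :* s :* η :- (k :- s :* (s :+ i)) :+ (k :- (s :+ b₁)))))
           refl k b₁ (fromℕ (c 0)) c₁ s η (φ 0) (φ 1) (φ 2) ⟩
    k * (φ 0 - φ 1) * (s * s * (c₁ - 1#) + (s * s * η - (k - s * (s + 1#)) + (k - (s + b₁))))
      ≈⟨ *-≈0 _ (+-≈0 (*-≈0 _ c₁≈1) (+-≈0 s²η≈ k≈s+b₁)) ⟩
    0# ∎)

  -- The square of the tail idempotent.

  module Tail {θ} (θ≈ : s * θ + k ≈ 0#) {ω} (ω-cosines : IsCosines θ ω) where

    private
      module ω = Cosines ω-cosines

      u : Carrier
      u = ω 1

      ω₀ : ω 0 - 1# ≈ 0#
      ω₀ = ≈⇒-≈0 ω.ω₀≈1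

      ku≈θ : k * u - θ ≈ 0#
      ku≈θ = begin
        k * u - θ
          ≈⟨ solve 5 (λ k w u θ c₀ → k :* u :- θ := (k :* w :+ (c₀ :* (w :- w) :+ k :* (u :- w)) :- θ :* w)
               :+ θ :* (w :- con (+ 1))) refl k (ω 0) u θ (fromℕ (c 0)) ⟩
        (B ω 0 - θ * ω 0) + θ * (ω 0 - 1#)
          ≈⟨ +-≈0 (≈⇒-≈0 (ω.recurrence (dist-refl y₀))) (*-≈0 _ ω₀) ⟩
        0# ∎

      su≈-1 : s * u + 1# ≈ 0#
      su≈-1 = *≈0⇒≈0 (>0⇒#0 k>0) (begin
        k * (s * u + 1#)                       ≈⟨ solve 4 (λ k s u θ → k :* (s :* u :+ con (+ 1)) := s :* (k :* u :- θ) :+ (s :* θ :+ k)) refl k s u θ ⟩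
        s * (k * u - θ) + (s * θ + k)          ≈⟨ +-≈0 (*-≈0 s ku≈θ) θ≈ ⟩
        0#                                     ∎)

      -- In the recurrence at distance one the terms `1 + a₁ u` add up to `-u`, which is `s u²`
      -- because `s u = -1`. This leaves `k u² = s u² + b₁ ω₂`.
      ω₂ : ω 2 - u * u ≈ 0#
      ω₂ = *≈0⇒≈0 (>0⇒#0 b₁>0) (begin
        b₁ * (ω 2 - u * u)
          ≈⟨ solve 8 (λ k s b₁ c₁ θ w u v → let i = con (+ 1) in
               b₁ :* (v :- u :* u) :=
               (k :* u :+ (c₁ :* (w :- u) :+ b₁ :* (v :- u)) :- θ :* u) :+ ((:- c₁) :* (w :- i) :+
               ((u :- i) :* (c₁ :- i) :+ ((:- u) :* (k :* u :- θ) :+ ((u :* u :- u) :* (k :- (s :+ b₁)) :+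
               (u :- i) :* (s :* u :+ i))))))
               refl k s b₁ c₁ θ (ω 0) u (ω 2) ⟩
        (B ω 1 - θ * u) + (- c₁ * (ω 0 - 1#) + ((u - 1#) * (c₁ - 1#) + (- u * (k * u - θ) +
          ((u * u - u) * (k - (s + b₁)) + (u - 1#) * (s * u + 1#)))))
          ≈⟨ +-≈0 (≈⇒-≈0 (ω.recurrence e₁)) (+-≈0 (*-≈0 _ ω₀) (+-≈0 (*-≈0 _ c₁≈1) (+-≈0 (*-≈0 _ ku≈θ)
               (+-≈0 (*-≈0 _ k≈s+b₁) (*-≈0 _ su≈-1))))) ⟩
        0# ∎)

    ω-weighted-sum : ∀ p φ → sum (λ q → ω (dist (embed p) (embed q)) * φ (dist (embed p) (embed q))) ≈ L φ
    ω-weighted-sum p φ = trans (sum-over-Q p (λ i → ω i * φ i)) (-≈0⇒≈ (begin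
      (ω 0 * φ 0 + ((s * s + 1#) * s * (u * φ 1) + s * s * (s * s) * (ω 2 * φ 2))) - L φ
        ≈⟨ solve 7 (λ s w u v f₀ f₁ f₂ → let i = con (+ 1); S = s :* u :+ i in
             (w :* f₀ :+ ((s :* s :+ i) :* s :* (u :* f₁) :+ s :* s :* (s :* s) :* (v :* f₂)))
             :- (f₀ :- (i :+ s :* s) :* f₁ :+ s :* s :* f₂) :=
             f₀ :* (w :- i) :+ (s :* s :* (s :* s) :* f₂ :* (v :- u :* u) :+
             ((s :* s :+ i) :* f₁ :+ s :* s :* f₂ :* (s :* u :- i)) :* S))
             refl s (ω 0) u (ω 2) (φ 0) (φ 1) (φ 2) ⟩
      φ 0 * (ω 0 - 1#) + (s * s * (s * s) * φ 2 * (ω 2 - u * u) +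
        ((s * s + 1#) * φ 1 + s * s * φ 2 * (s * u - 1#)) * (s * u + 1#))
        ≈⟨ +-≈0 (*-≈0 _ ω₀) (+-≈0 (*-≈0 _ ω₂) (*-≈0 _ su≈-1)) ⟩
      0# ∎))

    σ : Sequence
    σ i = ω i * ω i

    private
      -- For a quadrangle with parameters `s` and `t`, the sum of the cubed cosines over `Q` is
      -- `(1 - 1/s²)(1 - t/s²)`. It vanishes because `t = s²`, which is what the value of `c 2`
      -- provides.
      L-σ : L σ ≈ 0#
      L-σ = begin
        L σ
          ≈⟨ solve 4 (λ s w u v → let i = con (+ 1) in
               w :* w :- (i :+ s :* s) :* (u :* u) :+ s :* s :* (v :* v) :=
               (w :+ i) :* (w :- i) :+ (s :* s :* (v :+ u :* u) :* (v :- u :* u) :+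
               (i :- u :* u) :* (i :- s :* u) :* (s :* u :+ i)))
               refl s (ω 0) u (ω 2) ⟩
        (ω 0 + 1#) * (ω 0 - 1#) + (s * s * (ω 2 + u * u) * (ω 2 - u * u) +
          (1# - u * u) * (1# - s * u) * (s * u + 1#))
          ≈⟨ +-≈0 (*-≈0 _ ω₀) (+-≈0 (*-≈0 _ ω₂) (*-≈0 _ su≈-1)) ⟩
        0# ∎

    tensor-null : ∀ y x → sum (λ q → Φ ω (embed q) y * Φ σ (embed q) x) ≈ 0#
    tensor-null y x = trans
      (sum-cong (λ q → sym (*-assoc (Φ ω (embed q) y) (Φ ω (embed q) x) (Φ ω (embed q) x))))
      -- Two of the three tensor indices are set equal, so that the squared cosines `σ` appear.
      (cubic-null (λ a q → Φ ω (embed q) a) gram-cubes y x x)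
      where
      gram-cubes : sum (λ p → sum (λ q → gramₖ (λ a q → Φ ω (embed q) a) p q * gramₖ (λ a q → Φ ω (embed q) a) p q
                                         * gramₖ (λ a q → Φ ω (embed q) a) p q)) ≈ 0#
      gram-cubes = sum-0 λ p → begin
        sum (λ q → G p q * G p q * G p q)
          ≈⟨ sum-cong (λ q → *-cong (*-cong (g p q) (g p q)) (g p q)) ⟩
        sum (λ q → κω p q * κω p q * κω p q)
          ≈⟨ sum-cong (λ q → solve 2 (λ k w → k :* w :* (k :* w) :* (k :* w) := k :* k :* k :* (w :* (w :* w)))
               refl ω.κ (ω (dist (embed p) (embed q)))) ⟩
        sum (λ q → ω.κ * ω.κ * ω.κ * (ω (dist (embed p) (embed q)) * σ (dist (embed p) (embed q))))
          ≈⟨ *-distribˡ-sum (ω.κ * ω.κ * ω.κ) (λ q → ω (dist (embed p) (embed q)) * σ (dist (embed p) (embed q))) ⟨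
        ω.κ * ω.κ * ω.κ * sum (λ q → ω (dist (embed p) (embed q)) * σ (dist (embed p) (embed q)))
          ≈⟨ *-≈0 _ (trans (ω-weighted-sum p σ) L-σ) ⟩
        0# ∎
        where
        G κω : Kernel
        G = gramₖ (λ a q → Φ ω (embed q) a)
        κω p q = ω.κ * ω (dist (embed p) (embed q))
        g : ∀ p q → G p q ≈ κω p q
        g p q = ω.gram (embed p) (embed q)

    -- `Φ h` is the product of `Φ σ` and `Φ ψ`. Applying `(A - k)(A - η)` to its first factor turns
    -- it into the square of `Φ ψ`, so the squared norm of a row of `Φ ψ` is `quadratic h 0`, a
    -- multiple of `L h`.
    quadratic-σ : ∀ y x → Φ (quadratic σ) y x ≈ 0#
    quadratic-σ = Φ-vanishes ψ {y₀} (begin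
      ⟨ Φ ψ y₀ , Φ ψ y₀ ⟩    ≈⟨ shift-intertwines k (shift η σ) (shift η h) (shift-intertwines η σ h h≈) y₀ ⟩
      quadratic h (dist y₀ y₀) ≡⟨ ≡.cong (quadratic h) (dist-refl y₀) ⟩
      quadratic h 0          ≈⟨ *≈0⇒≈0 (#0⇒product#0 s#0 s#0) (trans (quadratic₀ h) (*-≈0 _ L-h)) ⟩
      0#                     ∎)
      where
      ψ h : Sequence
      ψ = quadratic σ
      h = proj₁ (Φ-product σ ψ)
      h≈ : ∀ x → ⟨ Φ σ x , Φ ψ y₀ ⟩ ≈ Φ h y₀ x
      h≈ = proj₂ (Φ-product σ ψ) y₀

      L-h : L h ≈ 0#
      L-h = begin
        L h
          ≈⟨ ω-weighted-sum p₀ h ⟨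
        sum (λ q → ω (dist y₀ (embed q)) * h (dist y₀ (embed q)))
          ≈⟨ sum-cong (λ q → *-cong (reflexive (≡.cong ω (dist-sym y₀ (embed q)))) (sym (h≈ (embed q)))) ⟩
        sum (λ q → Φ ω (embed q) y₀ * sum (λ x → Φ σ (embed q) x * Φ ψ y₀ x))
          ≈⟨ sum-cong (λ q → *-distribˡ-sum (Φ ω (embed q) y₀) (λ x → Φ σ (embed q) x * Φ ψ y₀ x)) ⟩
        sum (λ q → sum (λ x → Φ ω (embed q) y₀ * (Φ σ (embed q) x * Φ ψ y₀ x)))
          -- With the sum over `Q` innermost, `tensor-null` kills the contribution of each `x`
          -- separately.
          ≈⟨ ∑-comm (λ q x → Φ ω (embed q) y₀ * (Φ σ (embed q) x * Φ ψ y₀ x)) ⟩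
        sum (λ x → sum (λ q → Φ ω (embed q) y₀ * (Φ σ (embed q) x * Φ ψ y₀ x)))
          ≈⟨ sum-0 (λ x → begin
               sum (λ q → Φ ω (embed q) y₀ * (Φ σ (embed q) x * Φ ψ y₀ x))
                 ≈⟨ sum-cong (λ q → *-assoc (Φ ω (embed q) y₀) (Φ σ (embed q) x) (Φ ψ y₀ x)) ⟨
               sum (λ q → Φ ω (embed q) y₀ * Φ σ (embed q) x * Φ ψ y₀ x)
                 ≈⟨ *-distribʳ-sum (Φ ψ y₀ x) (λ q → Φ ω (embed q) y₀ * Φ σ (embed q) x) ⟨
               sum (λ q → Φ ω (embed q) y₀ * Φ σ (embed q) x) * Φ ψ y₀ x
                 ≈⟨ *-congʳ (tensor-null y₀ x) ⟩
               0# * Φ ψ y₀ x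
                 ≈⟨ zeroˡ _ ⟩
               0# ∎) ⟩
        0# ∎

    private
      den>0 : 0# < k * a + s
      den>0 = >0-+-≥0 (*-pos k>0 a>0) (>0⇒≥0 s>0)

      ka#0 : (k * a) # 0#
      ka#0 = #0⇒product#0 (>0⇒#0 k>0) (>0⇒#0 a>0)

      -- The coefficients of `σ = r + g ρ`, with `ρ` the cosines of `η`. Applying `A - η` leaves
      -- `(k - η) r = χ 0`; since `s² χ 0 = s (s + 1)` and `s² (k - η) = (s + 1)(k a + s)`, this
      -- gives `r = s / (k a + s)`. Evaluation at distance zero gives `g = 1 - r`.
      den⁻¹ ka⁻¹ r g g⁻¹ : Carrier
      den⁻¹ = proj₁ (#0⇒inverse (>0⇒#0 den>0))
      ka⁻¹  = proj₁ (#0⇒inverse ka#0)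
      r     = den⁻¹ * s
      g     = den⁻¹ * (k * a)
      g⁻¹   = ka⁻¹ * (k * a + s)

      den⁻¹-inverse : den⁻¹ * (k * a + s) - 1# ≈ 0#
      den⁻¹-inverse = ≈⇒-≈0 (proj₂ (#0⇒inverse (>0⇒#0 den>0)))

      ka⁻¹-inverse : ka⁻¹ * (k * a) - 1# ≈ 0#
      ka⁻¹-inverse = ≈⇒-≈0 (proj₂ (#0⇒inverse ka#0))

      g⁻¹-inverse : g⁻¹ * g - 1# ≈ 0#
      g⁻¹-inverse = begin
        g⁻¹ * g - 1#
          ≈⟨ solve 4 (λ j v i e → j :* v :* (i :* e) :- con (+ 1) :=
               j :* e :* (i :* v :- con (+ 1)) :+ (j :* e :- con (+ 1))) refl ka⁻¹ (k * a + s) den⁻¹ (k * a) ⟩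
        ka⁻¹ * (k * a) * (den⁻¹ * (k * a + s) - 1#) + (ka⁻¹ * (k * a) - 1#)
          ≈⟨ +-≈0 (*-≈0 _ den⁻¹-inverse)
               ka⁻¹-inverse ⟩
        0# ∎

      r+g≈1 : r + g - 1# ≈ 0#
      r+g≈1 = trans (solve 3 (λ i s e → i :* s :+ i :* e :- con (+ 1) := i :* (e :+ s) :- con (+ 1))
                       refl den⁻¹ s (k * a)) den⁻¹-inverse

      χ : Sequence
      χ = shift η σ

      -- `A - k` annihilates `Φ χ`, so its rows are `k`-eigenvectors, which are constant on a
      -- connected graph.
      χ-constant : ∀ y x → Φ χ y x - χ 0 ≈ 0#
      χ-constant y x = ≈⇒-≈0 (begin
        Φ χ y x        ≈⟨ k-eigenvector-constant (recurrence⇒eigenspace χ (λ y x → -≈0⇒≈ (quadratic-σ y x)) y) x y ⟩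
        χ (dist y y)   ≡⟨ ≡.cong χ (dist-refl y) ⟩
        χ 0            ∎)

      χ₀ : s * s * χ 0 - s * (s + 1#) ≈ 0#
      χ₀ = begin
        s * s * χ 0 - s * (s + 1#)
          ≈⟨ solve 6 (λ k c₀ s η w u → let i = con (+ 1) in
               s :* s :* (k :* (w :* w) :+ (c₀ :* (w :* w :- w :* w) :+ k :* (u :* u :- w :* w)) :- η :* (w :* w))
               :- s :* (s :+ i) :=
               k :* (s :* u :- i) :* (s :* u :+ i) :+ ((:- i) :* (s :* s :* η :- (k :- s :* (s :+ i))) :+
               (:- (s :* s :* η :* (w :+ i))) :* (w :- i)))
               refl k (fromℕ (c 0)) s η (ω 0) u ⟩
        k * (s * u - 1#) * (s * u + 1#) + (- 1# * (s * s * η - (k - s * (s + 1#))) +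
          - (s * s * η * (ω 0 + 1#)) * (ω 0 - 1#))
          ≈⟨ +-≈0 (*-≈0 _ su≈-1) (+-≈0 (*-≈0 _ s²η≈) (*-≈0 _ ω₀)) ⟩
        0# ∎

      k-η>0 : 0# < s * s * (k - η)
      k-η>0 = <-resp refl (begin
        (s + 1#) * (k * a + s)
          ≈⟨ solve 3 (λ k a η → let i = con (+ 1); s = i :+ a in
               (s :+ i) :* (k :* a :+ s) := s :* s :* (k :- η) :+ (s :* s :* η :- (k :- s :* (s :+ i))))
               refl k a η ⟩
        s * s * (k - η) + (s * s * η - (k - s * (s + 1#)))   ≈⟨ +-congˡ s²η≈ ⟩
        s * s * (k - η) + 0#                                 ≈⟨ +-identityʳ _ ⟩
        s * s * (k - η)                                      ∎)
        (*-pos (>0-+-≥0 s>0 (>0⇒≥0 0<1)) den>0)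

      [k-η]r≈χ₀ : (k - η) * r - χ 0 ≈ 0#
      [k-η]r≈χ₀ = *≈0⇒≈0 (#0⇒product#0 s#0 s#0) (begin
        s * s * ((k - η) * r - χ 0)
          ≈⟨ solve 5 (λ k a η j x → let i = con (+ 1); s = i :+ a; r = j :* s in
               s :* s :* ((k :- η) :* r :- x) :=
               (s :+ i) :* s :* (j :* (k :* a :+ s) :- i) :+
               ((:- r) :* (s :* s :* η :- (k :- s :* (s :+ i))) :+ (:- i) :* (s :* s :* x :- s :* (s :+ i))))
               refl k a η den⁻¹ (χ 0) ⟩
        (s + 1#) * s * (den⁻¹ * (k * a + s) - 1#) +
          (- r * (s * s * η - (k - s * (s + 1#))) + - 1# * (s * s * χ 0 - s * (s + 1#)))
          ≈⟨ +-≈0 (*-≈0 _ den⁻¹-inverse) (+-≈0 (*-≈0 _ s²η≈) (*-≈0 _ χ₀)) ⟩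
        0# ∎)

    ρ : Sequence
    ρ i = g⁻¹ * (σ i - r)

    ρ-cosines : IsCosines η ρ
    ρ-cosines = record
      { ω₀≈1       = -≈0⇒≈ (begin
          g⁻¹ * (ω 0 * ω 0 - r) - 1#
            ≈⟨ solve 4 (λ j w r g → let i = con (+ 1) in
                 j :* (w :* w :- r) :- i :=
                 j :* (w :+ i) :* (w :- i) :+ ((:- j) :* (r :+ g :- i) :+ (j :* g :- i)))
                 refl g⁻¹ (ω 0) r g ⟩
          g⁻¹ * (ω 0 + 1#) * (ω 0 - 1#) + (- g⁻¹ * (r + g - 1#) + (g⁻¹ * g - 1#))
            ≈⟨ +-≈0 (*-≈0 _ ω₀) (+-≈0 (*-≈0 _ r+g≈1) g⁻¹-inverse) ⟩
          0# ∎)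
      ; eigenspace = recurrence⇒eigenspace ρ λ y x → -≈0⇒≈ (recurrence y x)
      }
      where
      recurrence : ∀ y x → Φ (B ρ) y x - η * Φ ρ y x ≈ 0#
      recurrence y x = begin
        B ρ d - η * ρ d
          ≈⟨ solve 10 (λ k c b η j r f₋ f f₊ x →
               k :* (j :* (f :- r)) :+ (c :* (j :* (f₋ :- r) :- j :* (f :- r)) :+ b :* (j :* (f₊ :- r) :- j :* (f :- r)))
               :- η :* (j :* (f :- r)) :=
               j :* (k :* f :+ (c :* (f₋ :- f) :+ b :* (f₊ :- f)) :- η :* f :- x) :+
               (:- j) :* ((k :- η) :* r :- x))
               refl k (fromℕ (c d)) (fromℕ (b d)) η g⁻¹ r (σ (ℕ.pred d)) (σ d) (σ (suc d)) (χ 0) ⟩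
        g⁻¹ * (χ d - χ 0) + - g⁻¹ * ((k - η) * r - χ 0)
          ≈⟨ +-≈0 (*-≈0 _ (χ-constant y x)) (*-≈0 _ [k-η]r≈χ₀) ⟩
        0# ∎
        where
        d = dist y x

    σ-decomposition : ∀ i → σ i ≈ r + g * ρ i
    σ-decomposition i = -≈0⇒≈ (begin
      σ i - (r + g * ρ i)
        ≈⟨ solve 4 (λ f r g j → f :- (r :+ g :* (j :* (f :- r))) := (r :- f) :* (j :* g :- con (+ 1)))
             refl (σ i) r g g⁻¹ ⟩
      (r - σ i) * (g⁻¹ * g - 1#)
        ≈⟨ *-≈0 _ g⁻¹-inverse ⟩
      0# ∎)

    -- The position of `η` among the eigenvalues.

    -- The entrywise product of the two Gram matrices over `Q` is positive semidefinite, so its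
    -- entries have a nonnegative sum. Each of the `m` rows contributes the same positive multiple
    -- of `L τ`.
    L≥0 : ∀ {ν τ} → IsCosines ν τ → L τ ≥0
    L≥0 {τ = τ} τ-cosines = *-cancel-≥0 (*-pos (fromℕ>0 p₀) (*-pos (ω.κ>0 y₀) (τ.κ>0 y₀)))
      (≥0-resp-≈ (begin
        sum (λ p → sum (λ q → gramₖ (λ a q → Φ ω (embed q) a) p q * gramₖ (λ a q → Φ τ (embed q) a) p q))
          ≈⟨ sum-cong row ⟩
        sum {m} (λ p → ω.κ * τ.κ * L τ)    ≈⟨ sum-const {m} (ω.κ * τ.κ * L τ) ⟩
        fromℕ m * (ω.κ * τ.κ * L τ)        ≈⟨ *-assoc _ _ _ ⟨
        fromℕ m * (ω.κ * τ.κ) * L τ        ∎)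
        (product-gram≥0 (λ a q → Φ ω (embed q) a) (λ a q → Φ τ (embed q) a)))
      where
      module τ = Cosines τ-cosines
      row : ∀ p → sum (λ q → gramₖ (λ a q → Φ ω (embed q) a) p q * gramₖ (λ a q → Φ τ (embed q) a) p q) ≈
                  ω.κ * τ.κ * L τ
      row p = begin
        sum (λ q → gramₖ (λ a q → Φ ω (embed q) a) p q * gramₖ (λ a q → Φ τ (embed q) a) p q)
          ≈⟨ sum-cong (λ q → *-cong (ω.gram (embed p) (embed q)) (τ.gram (embed p) (embed q))) ⟩
        sum (λ q → ω.κ * Φ ω (embed p) (embed q) * (τ.κ * Φ τ (embed p) (embed q)))
          ≈⟨ sum-cong (λ q → solve 4 (λ k w l t → k :* w :* (l :* t) := k :* l :* (w :* t)) refl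
               ω.κ (Φ ω (embed p) (embed q)) τ.κ (Φ τ (embed p) (embed q))) ⟩
        sum (λ q → ω.κ * τ.κ * (Φ ω (embed p) (embed q) * Φ τ (embed p) (embed q)))
          ≈⟨ *-distribˡ-sum (ω.κ * τ.κ) (λ q → Φ ω (embed p) (embed q) * Φ τ (embed p) (embed q)) ⟨
        ω.κ * τ.κ * sum (λ q → Φ ω (embed p) (embed q) * Φ τ (embed p) (embed q))
          ≈⟨ *-congˡ (ω-weighted-sum p τ) ⟩
        ω.κ * τ.κ * L τ ∎

    -- On the rows of `Φ τ` the operator `(A - η)(A - k)` acts as a scalar; the recurrences at
    -- distances zero and one suffice to see this on the diagonal.
    quadratic-cosines₀ : ∀ {ν τ} → IsCosines ν τ → quadratic τ 0 ≈ (ν - η) * (ν - k)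
    quadratic-cosines₀ {ν} {τ} τ-cosines = -≈0⇒≈ (begin
      quadratic τ 0 - (ν - η) * (ν - k)
        ≈⟨ solve 9 (λ k c₀ c₁ b₁ η ν t₀ t₁ t₂ →
             let i = con (+ 1)
                 B₀ = k :* t₀ :+ (c₀ :* (t₀ :- t₀) :+ k :* (t₁ :- t₀))
                 B₁ = k :* t₁ :+ (c₁ :* (t₀ :- t₁) :+ b₁ :* (t₂ :- t₁))
                 χ₀ = B₀ :- η :* t₀
                 χ₁ = B₁ :- η :* t₁
             in k :* χ₀ :+ (c₀ :* (χ₀ :- χ₀) :+ k :* (χ₁ :- χ₀)) :- k :* χ₀ :- (ν :- η) :* (ν :- k) :=
                k :* (B₁ :- ν :* t₁) :+ ((ν :- η :- k) :* (B₀ :- ν :* t₀) :+ (ν :- η) :* (ν :- k) :* (t₀ :- i)))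
             refl k (fromℕ (c 0)) c₁ b₁ η ν (τ 0) (τ 1) (τ 2) ⟩
      k * (B τ 1 - ν * τ 1) + ((ν - η - k) * (B τ 0 - ν * τ 0) + (ν - η) * (ν - k) * (τ 0 - 1#))
        ≈⟨ +-≈0 (*-≈0 _ (≈⇒-≈0 (recurrence e₁))) (+-≈0 (*-≈0 _ (≈⇒-≈0 (recurrence (dist-refl y₀)))) (*-≈0 _ (≈⇒-≈0 ω₀≈1))) ⟩
      0# ∎)
      where open IsCosines τ-cosines

    no-eigenvalue-between-η-and-k : ∀ {ν} → IsEigenvalue (adjacencyMatrix Γ) ν → ν < k → ¬ (η < ν)
    no-eigenvalue-between-η-and-k {ν} ν-eigenvalue ν<k η<ν = L≥0 τ-cosines (0<-⇒< 0<-L)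
      where
      τ : Sequence
      τ = proj₁ (eigenvalue⇒cosines ν-eigenvalue)
      τ-cosines : IsCosines ν τ
      τ-cosines = proj₂ (eigenvalue⇒cosines ν-eigenvalue)
      identity : s * s * ((ν - η) * (k - ν)) ≈ k * b₁ * (0# - L τ)
      identity = begin
        s * s * ((ν - η) * (k - ν))
          ≈⟨ solve 4 (λ s ν η k → s :* s :* ((ν :- η) :* (k :- ν)) := :- (s :* s :* ((ν :- η) :* (ν :- k))))
               refl s ν η k ⟩
        - (s * s * ((ν - η) * (ν - k)))    ≈⟨ -‿cong (*-congˡ (sym (quadratic-cosines₀ τ-cosines))) ⟩
        - (s * s * quadratic τ 0)          ≈⟨ -‿cong (quadratic₀ τ) ⟩
        - (k * b₁ * L τ)                   ≈⟨ solve 2 (λ x l → :- (x :* l) := x :* (con (+ 0) :- l)) refl (k * b₁) (L τ) ⟩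
        k * b₁ * (0# - L τ)                ∎
      0<product : 0# < s * s * ((ν - η) * (k - ν))
      0<product = *-pos (*-pos s>0 s>0) (*-pos (<⇒0<- η<ν) (<⇒0<- ν<k))
      0<-L : 0# < 0# - L τ
      0<-L = *-cancel->0 {k * b₁} (*-pos k>0 b₁>0) (<-resp refl identity 0<product)

    -- The sequence `ρ` makes `η` an eigenvalue, so it has an index. Index zero would force `η ≈ k`,
    -- and an index of two or more would place `θs 1` strictly between `η` and `k`.
    second-eigenvalue : ∀ {θs} → DistinctEigenvalues (adjacencyMatrix Γ) D θs → θs 1 ≈ η
    second-eigenvalue {θs} distinct = from-index (exhaustive (cosines⇒eigenvalue y₀ ρ-cosines))
      where
      open DistinctEigenvalues distinct
      θ₀≈k : θs 0 ≈ k
      θ₀≈k = largest-eigenvalue y₀ distinct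
      from-index : ∃[ j ] (j ℕ.≤ D × η ≈ θs j) → θs 1 ≈ η
      from-index (0 , _ , η≈θ₀) =
        contradiction k-η>0 (<.irrefl (sym (*-≈0 (s * s) (≈⇒-≈0 (trans (sym θ₀≈k) (sym η≈θ₀))))))
      from-index (1 , _ , η≈θ₁) = sym η≈θ₁
      from-index (suc (suc j) , j≤D , η≈θⱼ) = ⊥-elim (no-eigenvalue-between-η-and-k (eigenvalues 1≤D)
        (<-resp refl θ₀≈k (decreasing (s≤s z≤n) 1≤D))
        (<-resp (sym η≈θⱼ) refl (decreasing (s≤s (s≤s z≤n)) j≤D)))
        where
        1≤D : 1 ℕ.≤ D
        1≤D = ℕ.≤-trans (s≤s z≤n) j≤D

    -- The light tail relation for the given projections.

    module _ {θ₀ ν} {E₀ E F : Matrix n} (θ₀≈k : θ₀ ≈ k) (ν≈η : ν ≈ η)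
      (E₀-projection : IsOrthogonalProjection E₀ (Eigenspace (adjacencyMatrix Γ) θ₀))
      (E-projection : IsOrthogonalProjection E (Eigenspace (adjacencyMatrix Γ) θ))
      (F-projection : IsOrthogonalProjection F (Eigenspace (adjacencyMatrix Γ) ν)) where

      private
        ν-cosines : IsCosines ν ρ
        ν-cosines = IsCosines-resp-≈ (sym ν≈η) ρ-cosines

        module ϵ = Cosines (IsCosines-resp-≈ (sym θ₀≈k) k-cosines)
        module ρ = Cosines ν-cosines

        κ⁻¹ : Carrier
        κ⁻¹ = proj₁ (#0⇒inverse (>0⇒#0 (ω.κ>0 y₀)))

        κ⁻¹κ≈1 : κ⁻¹ * ω.κ ≈ 1#
        κ⁻¹κ≈1 = proj₂ (#0⇒inverse (>0⇒#0 (ω.κ>0 y₀)))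

        κ⁻¹#0 : κ⁻¹ # 0#
        κ⁻¹#0 = inverse⇒#0 (trans (*-comm _ _) κ⁻¹κ≈1)

        den⁻¹#0 : den⁻¹ # 0#
        den⁻¹#0 = inverse⇒#0 (trans (*-comm _ _) (-≈0⇒≈ den⁻¹-inverse))

        r#0 : r # 0#
        r#0 = #0⇒product#0 den⁻¹#0 s#0

        g#0 : g # 0#
        g#0 = #0⇒product#0 den⁻¹#0 ka#0

        κ⁻²#0 : (κ⁻¹ * κ⁻¹) # 0#
        κ⁻²#0 = #0⇒product#0 κ⁻¹#0 κ⁻¹#0

        E∘E : ∀ x y → E x y * E x y ≈ κ⁻¹ * κ⁻¹ * (r * ϵ.κ) * E₀ x y + κ⁻¹ * κ⁻¹ * (g * ρ.κ) * F x y
        E∘E x y = begin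
          E x y * E x y
            ≈⟨ *-cong scaled scaled ⟩
          κ⁻¹ * ω d * (κ⁻¹ * ω d)
            ≈⟨ solve 2 (λ i w → i :* w :* (i :* w) := i :* i :* (w :* w)) refl κ⁻¹ (ω d) ⟩
          κ⁻¹ * κ⁻¹ * σ d
            ≈⟨ *-congˡ (σ-decomposition d) ⟩
          κ⁻¹ * κ⁻¹ * (r + g * ρ d)
            ≈⟨ solve 4 (λ i r g p → i :* (r :+ g :* p) := i :* r :* con (+ 1) :+ i :* g :* p)
                 refl (κ⁻¹ * κ⁻¹) r g (ρ d) ⟩
          κ⁻¹ * κ⁻¹ * r * 1# + κ⁻¹ * κ⁻¹ * g * ρ d
            ≈⟨ +-cong (*-congˡ (ϵ.projection E₀-projection x y)) (*-congˡ (ρ.projection F-projection x y)) ⟨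
          κ⁻¹ * κ⁻¹ * r * (ϵ.κ * E₀ x y) + κ⁻¹ * κ⁻¹ * g * (ρ.κ * F x y)
            ≈⟨ solve 7 (λ i r k e g l f → i :* r :* (k :* e) :+ i :* g :* (l :* f) :=
                 i :* (r :* k) :* e :+ i :* (g :* l) :* f)
                 refl (κ⁻¹ * κ⁻¹) r ϵ.κ (E₀ x y) g ρ.κ (F x y) ⟩
          κ⁻¹ * κ⁻¹ * (r * ϵ.κ) * E₀ x y + κ⁻¹ * κ⁻¹ * (g * ρ.κ) * F x y ∎
          where
          d = dist x y
          scaled : E x y ≈ κ⁻¹ * ω d
          scaled = begin
            E x y                    ≈⟨ *-identityˡ _ ⟨
            1# * E x y               ≈⟨ *-congʳ κ⁻¹κ≈1 ⟨
            κ⁻¹ * ω.κ * E x y        ≈⟨ *-assoc _ _ _ ⟩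
            κ⁻¹ * (ω.κ * E x y)      ≈⟨ *-congˡ (ω.projection E-projection x y) ⟩
            κ⁻¹ * ω d                ∎

        E₀-constant : E₀ y₀ y₀ ≈ E₀ y₀ y₁
        E₀-constant = *-cancel-#0 (>0⇒#0 (ϵ.κ>0 y₀))
          (trans (ϵ.projection E₀-projection y₀ y₀) (sym (ϵ.projection E₀-projection y₀ y₁)))

        -- The right side is `s² - 1`, that is, `s² (1 - ω₁²)`. It is positive because `a₁` is
        -- nonzero, and this prevents `F` from being constant.
        g[1-ρ₁] : s * s * (g * (ρ.κ * (F y₀ y₀ - F y₀ y₁))) ≈ a * (s + 1#)
        g[1-ρ₁] = begin
          s * s * (g * (ρ.κ * (F y₀ y₀ - F y₀ y₁)))
            ≈⟨ *-congˡ (*-congˡ (solve 3 (λ k e f → k :* (e :- f) := k :* e :- k :* f) refl ρ.κ (F y₀ y₀) (F y₀ y₁))) ⟩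
          s * s * (g * (ρ.κ * F y₀ y₀ - ρ.κ * F y₀ y₁))
            ≈⟨ *-congˡ (*-congˡ (+-cong
                 (trans (ρ.projection F-projection y₀ y₀) (reflexive (≡.cong ρ (dist-refl y₀))))
                 (-‿cong (trans (ρ.projection F-projection y₀ y₁) (reflexive (≡.cong ρ e₁)))))) ⟩
          s * s * (g * (ρ 0 - ρ 1))
            ≈⟨ *-congˡ (solve 4 (λ r g p q → g :* (p :- q) := (r :+ g :* p) :- (r :+ g :* q)) refl r g (ρ 0) (ρ 1)) ⟩
          s * s * ((r + g * ρ 0) - (r + g * ρ 1))
            ≈⟨ *-congˡ (+-cong (σ-decomposition 0) (-‿cong (σ-decomposition 1))) ⟨
          s * s * (σ 0 - σ 1)
            ≈⟨ -≈0⇒≈ identity ⟩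
          a * (s + 1#) ∎
          where
          identity : s * s * (σ 0 - σ 1) - a * (s + 1#) ≈ 0#
          identity = begin
            s * s * (σ 0 - σ 1) - a * (s + 1#)
              ≈⟨ solve 3 (λ a w u → let i = con (+ 1); s = i :+ a in
                   s :* s :* (w :* w :- u :* u) :- a :* (s :+ i) :=
                   s :* s :* (w :+ i) :* (w :- i) :+ (i :- s :* u) :* (s :* u :+ i))
                   refl a (ω 0) u ⟩
            s * s * (ω 0 + 1#) * (ω 0 - 1#) + (1# - s * u) * (s * u + 1#)
              ≈⟨ +-≈0 (*-≈0 _ ω₀) (*-≈0 _ su≈-1) ⟩
            0# ∎

        F-varies : F y₀ y₀ # F y₀ y₁
        F-varies = -#0⇒# (product#0⇒#0ʳ {ρ.κ} (product#0⇒#0ʳ {g} (product#0⇒#0ʳ {s * s} product#0)))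
          where
          a[s+1]>0 : 0# < a * (s + 1#)
          a[s+1]>0 = *-pos a>0 (>0-+-≥0 s>0 (>0⇒≥0 0<1))
          product#0 : (s * s * (g * (ρ.κ * (F y₀ y₀ - F y₀ y₁)))) # 0#
          product#0 = #-resp (sym g[1-ρ₁]) refl (>0⇒#0 a[s+1]>0)

        -- An explicit entry is needed. `F` has apart values at two places where `E₀` has equal
        -- ones, so cotransitivity yields a place where the two matrices are apart.
        F≠E₀ : ∃₂ λ x y → F x y # E₀ x y
        F≠E₀ = [ (λ F#E₀ → y₀ , y₀ , F#E₀) , (λ E₀#F → y₀ , y₁ , #-sym (#-resp E₀-constant refl E₀#F)) ]′
          (#-cotrans F-varies (E₀ y₀ y₀))

      light-tail : IsLightTail (adjacencyMatrix Γ) E₀ E F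
      light-tail = record
        { E-minimal = θ , cosines⇒eigenvalue y₀ ω-cosines , E-projection
        ; F-minimal = ν , cosines⇒eigenvalue y₀ ν-cosines , F-projection
        ; F≠E₀      = F≠E₀
        ; α         = κ⁻¹ * κ⁻¹ * (r * ϵ.κ)
        ; β         = κ⁻¹ * κ⁻¹ * (g * ρ.κ)
        ; α≠0       = #0⇒product#0 κ⁻²#0 (#0⇒product#0 r#0 (>0⇒#0 (ϵ.κ>0 y₀)))
        ; β≠0       = #0⇒product#0 κ⁻²#0 (#0⇒product#0 g#0 (>0⇒#0 (ρ.κ>0 y₀)))
        ; E∘E       = E∘E
        }

-- From the hypotheses of the theorem to the parameters above.

-- A truncated difference that is nonzero was not truncated, so `a₁ ≢ 0` recovers the genuine
-- relation between `k`, `a₁` and `b 1`.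
∸∸1≢0⇒≡ : ∀ k b {c} → c ≡ 1 → k ℕ.∸ b ℕ.∸ c ≢ 0 → k ≡ suc (k ℕ.∸ b ℕ.∸ c) ℕ.+ b
∸∸1≢0⇒≡ k b ≡.refl k∸b∸1≢0 with k ℕ.∸ b in eq
... | zero  = contradiction ≡.refl k∸b∸1≢0
... | suc e = ≡.trans (≡.sym (ℕ.m∸n+n≡m {k} {b} (ℕ.<⇒≤ (ℕ.m∸n≢0⇒n<m {k} {b} λ k∸b≡0 →
                contradiction (≡.trans (≡.sym eq) k∸b≡0) λ ())))) (≡.cong (ℕ._+ b) eq)

distanceRegular-edge : ∀ {n D} {Γ : Graph n} {b c} → IsDistanceRegular Γ D b c → D ≢ 0 →
                       ∃₂ λ x y → Graph._~_ Γ x y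
distanceRegular-edge {D = zero}  _       0≢0 = contradiction ≡.refl 0≢0
distanceRegular-edge {D = suc _} regular _ with _ , _ , step x~z _ , _ ← IsDistanceRegular.attained regular =
  _ , _ , x~z

open import Data.Nat.Base using (_+_; _*_; _∸_; _^_; _≤_; _≥_)

theorem3p3 : ∀ {ℓ ℓ₁ ℓ₂ : Level} (ℝ : RealNumbers ℓ ℓ₁ ℓ₂) →
    let open Spectral ℝ in
    ∀ {n D : ℕ} (Γ : Graph n) (b c : ℕ → ℕ) → IsDistanceRegular Γ D b c →
    let k  = b 0
        a₁ = intersection-a b c 1
        A  = adjacencyMatrix Γ
    in
    k ≥ 3 → D ≥ 2 → a₁ ≢ 0 →
    (θ : ℕ → Carrier) → DistinctEigenvalues A D θ →
    (E : ℕ → Matrix n) →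
    (∀ {i} → i ≤ D → IsOrthogonalProjection (E i) (Eigenspace A (θ i))) →
    θ D ≈ - (fromℕ k ÷ suc a₁) →
    c 2 ≡ suc a₁ ^ 2 + 1 →
    ContainsInducedGQ (suc a₁) (c 2 ∸ 1) Γ →
    (θ 1 ≈ (fromℕ k - fromℕ (suc a₁ * (a₁ + 2))) ÷ (suc a₁ ^ 2)) ×
    IsLightTail A (E 0) (E D) (E 1)
theorem3p3 ℝ {D = D} Γ b c regular _ D≥2 a₁≢0 θ distinct E projections θD≈ c₂≡
  (_ , Q , (_ , bQ , cQ , Q-regular , bQ₀≡ , bQ₁≡ , _ , cQ₂≡) , Q⊆Γ) =
  second-eigenvalue distinct ,
  light-tail (largest-eigenvalue y distinct) (second-eigenvalue distinct)
    (projections z≤n) (projections ℕ.≤-refl) (projections (ℕ.≤-trans (s≤s z≤n) D≥2))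
  where
  open Spectral ℝ using (fromℕ; _÷_; module DistinctEigenvalues)
  module R = RealProperties ℝ
  open DistanceRegular ℝ Γ b c regular using (eigenvalue⇒cosines; c₁≡1; largest-eigenvalue)
  edge = distanceRegular-edge regular λ { ≡.refl → contradiction D≥2 λ () }
  y = proj₁ edge

  a₁ : ℕ
  a₁ = intersection-a b c 1

  t≡ : c 2 ∸ 1 ≡ suc a₁ ^ 2
  t≡ = ≡.trans (≡.cong (_∸ 1) c₂≡) (ℕ.m+n∸n≡m (suc a₁ ^ 2) 1)

  open GQ-LightTail ℝ Γ b c regular a₁ a₁≢0
    (∸∸1≢0⇒≡ (b 0) (b 1) (c₁≡1 (proj₂ (proj₂ edge))) a₁≢0) Q bQ cQ Q-regular Q⊆Γ
    (≡.trans bQ₀≡ (≡.cong (λ t → (t + 1) * suc a₁) t≡))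
    (≡.trans bQ₁≡ (≡.cong (_* suc a₁) t≡))
    (≡.trans cQ₂≡ (≡.cong (_+ 1) t≡))

  sθ+k≈0 : fromℕ (suc a₁) R.* θ D R.+ fromℕ (b 0) R.≈ R.0#
  sθ+k≈0 = begin
    s R.* θ D R.+ k                  ≈⟨ R.+-congʳ (R.*-congˡ θD≈) ⟩
    s R.* (R.- (k ÷ suc a₁)) R.+ k   ≈⟨ R.solve 3 (λ s q k → s R.:* (R.:- q) R.:+ k R.:= k R.:- q R.:* s) R.refl s (k ÷ suc a₁) k ⟩
    k R.- (k ÷ suc a₁) R.* s         ≈⟨ R.≈⇒-≈0 (R.sym (R.÷-correct k (suc a₁))) ⟩
    R.0#                             ∎
    where open SetoidReasoning R.setoid

  open Tail sθ+k≈0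
    (proj₂ (eigenvalue⇒cosines (DistinctEigenvalues.eigenvalues distinct ℕ.≤-refl)))
    using (second-eigenvalue; light-tail)
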